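{- Let $n\ge 4$. For $2\le s\le\lfloor\frac n2\rfloor$ we have $rn(S^1_{n,s})=rn(S_{n,s})$, and for $3\le s\le\lfloor\frac n2\rfloor$ we have $rn(S^2_{n,s})=rn(S_{n,s})$ and $rn(S^{1,2}_{n,s})=rn(S_{n,s})$.
   Context: For a connected graph $G$, $d(u,v)$ is graph distance and $\mathrm{diam}(G)$ the diameter. A radio labeling of $G$ is a function $c:V(G)\to\mathbb{Z}_{+}$ (positive integers) such that for all distinct $u,v$, $d(u,v)+|c(u)-c(v)|\ge\mathrm{diam}(G)+1$; its span is its maximum value, and $rn(G)$ is the minimum span over all radio labelings. All graphs below have vertices $v_1,\dots,v_n$ and contain the path edges $\{v_i,v_{i+1}\}$, $i=1,\dots,n-2$. The spire graph $S_{n,s}$ ($2\le s\le n-2$) additionally has the edge $\{v_s,v_n\}$. The graph $S^1_{n,s}$ ($2\le s\le n$) additionally has edges $\{v_s,v_n\}$ and $\{v_{s-1},v_n\}$. The graph $S^2_{n,s}$ ($3\le s\le n$) additionally has edges $\{v_s,v_n\}$ and $\{v_{s-2},v_n\}$. The graph $S^{1,2}_{n,s}$ ($3\le s\le n$) additionally has edges $\{v_s,v_n\}$, $\{v_{s-1},v_n\}$ and $\{v_{s-2},v_n\}$. -}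

module Defs where

open import Data.Nat using (ℕ; zero; suc; _+_; _∸_; _≤_; _⊔_; ∣_-_∣)
open import Data.Fin using (Fin; toℕ)
open import Data.List using (List; []; _∷_; applyUpTo; foldr; map; allFin)
open import Data.List.Membership.Propositional using (_∈_)
open import Data.Product using (_×_; _,_; Σ; ∃; ∃-syntax)
open import Data.Sum using (_⊎_)
open import Relation.Binary.PropositionalEquality using (_≡_; _≢_)

-- A graph on vertex set Fin n (vertex v_i is represented by index i-1),
-- given by a list of (1-indexed) edges {a,b} written as pairs (a , b).
EdgeList : Set
EdgeList = List (ℕ × ℕ)

Adj : {n : ℕ} → EdgeList → Fin n → Fin n → Set
Adj E u v = ((suc (toℕ u) , suc (toℕ v)) ∈ E) ⊎ ((suc (toℕ v) , suc (toℕ u)) ∈ E)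

data Walk {n : ℕ} (E : EdgeList) : Fin n → Fin n → ℕ → Set where
  here : ∀ {u} → Walk E u u 0
  step : ∀ {u w v k} → Adj E u w → Walk E w v k → Walk E u v (suc k)

IsDist : {n : ℕ} → EdgeList → Fin n → Fin n → ℕ → Set
IsDist E u v d = Walk E u v d × (∀ k → Walk E u v k → d ≤ k)

IsDiam : (n : ℕ) → EdgeList → ℕ → Set
IsDiam n E D =
  (∀ (u v : Fin n) d → IsDist E u v d → d ≤ D) × (Σ (Fin n) λ u → Σ (Fin n) λ v → IsDist E u v D)

IsRadioLabeling : (n : ℕ) → EdgeList → (Fin n → ℕ) → Set
IsRadioLabeling n E c =
  (∀ v → 1 ≤ c v) ×
  (∀ D → IsDiam n E D → ∀ (u v : Fin n) → u ≢ v → ∀ d → IsDist E u v d →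
     suc D ≤ d + ∣ c u - c v ∣)

span : (n : ℕ) → (Fin n → ℕ) → ℕ
span n c = foldr _⊔_ 0 (map c (allFin n))

IsRadioNumber : (n : ℕ) → EdgeList → ℕ → Set
IsRadioNumber n E k =
  (Σ (Fin n → ℕ) λ c → IsRadioLabeling n E c × span n c ≡ k) ×
  (∀ c → IsRadioLabeling n E c → k ≤ span n c)

SameRadioNumber : (n : ℕ) → EdgeList → EdgeList → Set
SameRadioNumber n E F = ∃[ k ] (IsRadioNumber n E k × IsRadioNumber n F k)

pathEdges : ℕ → EdgeList
pathEdges n = applyUpTo (λ i → (suc i , suc (suc i))) (n ∸ 2)

Spire : ℕ → ℕ → EdgeList
Spire n s = (s , n) ∷ pathEdges n

Spire1 : ℕ → ℕ → EdgeList
Spire1 n s = (s , n) ∷ (s ∸ 1 , n) ∷ pathEdges n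

Spire2 : ℕ → ℕ → EdgeList
Spire2 n s = (s , n) ∷ (s ∸ 2 , n) ∷ pathEdges n

Spire12 : ℕ → ℕ → EdgeList
Spire12 n s = (s , n) ∷ (s ∸ 1 , n) ∷ (s ∸ 2 , n) ∷ pathEdges n

{-# OPTIONS --safe #-}
module Submission where

-- All graphs of the family lie between S_{n,s} and S^{1,2}_{n,s} and have diameter n - 2. A labeling of any of
-- them satisfies the constraints of the distances of S_{n,s}. Conversely, mapping v_n to v_{s-1} and fixing the
-- path is 1-Lipschitz on S^{1,2}_{n,s}, so spreading the labels with respect to the folded distance (at least 1)
-- suffices for every graph of the family. It remains to find one number that bounds the former labelings from
-- below and is attained by the latter.
--
-- For the lower bound, order the vertices by label. The distance of two vertices is at most the sum of their
-- distances to the middle of the path (plus 1 if there are two middle vertices), and summing over consecutive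
-- vertices bounds the span up to a nonnegative total slack. For one middle vertex the slack is at least 1, since
-- only one end of the order can be the middle. For two of them it is at least 1 because of v_{n-1}, which causes
-- slack at its two neighbours in the order, and at least 2 if v_s is not in the middle: otherwise v_{n-1} and
-- v_{n-2} occupy the positions next to the ends, and v_1 causes slack as well.

-- The middle meant here is the weight centre of the tree S_{n,s}, where v_n counts too, and need
-- not be that of the path. For n = 2k+1 it is v_k alone, although the path has two central
-- vertices; for n = 2j+2 and s ≤ j it is the edge between v_j and v_{j+1}, although the path has
-- the single centre v_{j+1}; for n = 2s it is v_s. No branch then holds more than half of the
-- vertices, so an order can keep switching branches, and its slack stays at 1 or 2. Folding
-- shortens only the distances from v_n to vertices before v_s. The orders that attain the bound
-- therefore put v_n between v_{n-1} and another vertex not before v_s: there the folded distances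
-- are those of S_{n,s}, and nothing is lost against the lower bound.

open import Defs
open import Data.Bool using (Bool; true; false)
open import Data.Empty using (⊥; ⊥-elim)
open import Data.Fin using (Fin; toℕ; fromℕ<)
open import Data.Fin.Properties using (toℕ-injective; toℕ-fromℕ<; toℕ<n; any?) renaming (_≟_ to _≟ᶠ_)
open import Data.List using (List; []; _∷_; map; foldr; length; allFin; applyUpTo)
open import Data.List.Properties using (length-applyUpTo)
open import Data.List.Membership.Propositional using (_∈_)
open import Data.List.Membership.Propositional.Properties using (∈-applyUpTo⁺; ∈-applyUpTo⁻; ∈-allFin)
import Data.List.Membership.DecPropositional as DecMembership
open import Data.List.Relation.Binary.Permutation.Propositional using (_↭_; ↭-sym; ↭⇒↭ₛ)
open import Data.List.Relation.Binary.Permutation.Propositional.Properties using (∈-resp-↭; ↭-length; map⁺)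
import Data.List.Relation.Binary.Permutation.Setoid.Properties as PermutationSetoid
open import Data.List.Relation.Binary.Subset.Propositional using (_⊆_)
open import Data.List.Relation.Unary.All as All using (All)
open import Data.List.Relation.Unary.AllPairs as AllPairs using (AllPairs)
open import Data.List.Relation.Unary.Any using (here; there)
open import Data.List.Relation.Unary.Sorted.TotalOrder.Properties using (Sorted⇒AllPairs)
open import Data.List.Relation.Unary.Unique.Propositional using (Unique)
open import Data.List.Relation.Unary.Unique.Propositional.Properties using (applyUpTo⁺₁)
import Data.List.Sort
open import Data.Nat using (ℕ; zero; suc; _+_; _*_; _∸_; _≤_; _<_; _⊔_; ∣_-_∣; _/_; z≤n; s≤s; _≟_; _≤?_; _<?_;
  compare; less; equal; greater)
open import Data.Nat.DivMod using (m/n*n≤m)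
open import Data.Nat.ListAction using (sum)
open import Data.Nat.ListAction.Properties using (sum-↭)
open import Data.Nat.Properties
open import Data.Nat.Tactic.RingSolver using (solve; solve-∀)
open import Data.Product using (_×_; _,_; ∃; ∃₂; proj₁; proj₂)
open import Data.Product.Properties using (≡-dec)
open import Data.Sum using (_⊎_; inj₁; inj₂; swap)
import Data.Sum as Sum
open import Function using (_∘_)
open import Level using (0ℓ)
open import Relation.Binary.Bundles using (DecTotalOrder)
import Relation.Binary.Construct.On as On
open import Relation.Binary.Definitions using (tri<; tri≈; tri>)
open import Relation.Binary.PropositionalEquality
open import Relation.Nullary using (¬_; Dec; yes; no; contradiction)
open import Relation.Nullary.Decidable using (map′; _×-dec_; _⊎-dec_)
open import Relation.Unary using (Decidable)

-- Shortest walks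

least : ∀ {P : ℕ → Set} → Decidable P → ∀ k → P k → ∃ λ d → d ≤ k × P d × (∀ j → P j → d ≤ j)
least P? zero    p = 0 , z≤n , p , λ _ _ → z≤n
least P? (suc k) p with P? 0
... | yes p₀ = 0 , z≤n , p₀ , λ _ _ → z≤n
... | no ¬p₀ with least (λ j → P? (suc j)) k p
...   | d , d≤k , pd , d-least = suc d , s≤s d≤k , pd , λ
        { zero p₀ → contradiction p₀ ¬p₀ ; (suc j) pj → s≤s (d-least j pj) }

module _ {n : ℕ} where

  adj? : ∀ E (u v : Fin n) → Dec (Adj E u v)
  adj? E u v = (_ ∈? E) ⊎-dec (_ ∈? E)
    where open DecMembership (≡-dec _≟_ _≟_) using (_∈?_)

  walk? : ∀ E (u v : Fin n) → Decidable (Walk E u v)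
  walk? E u v zero    = map′ (λ { refl → here }) (λ { here → refl }) (u ≟ᶠ v)
  walk? E u v (suc k) = map′ (λ { (_ , e , w) → step e w }) (λ { (step e w) → _ , e , w })
    (any? λ x → adj? E u x ×-dec walk? E x v k)

  -- `IsDist` asks for a minimal length. Walks of a fixed length are decidable, so a search up to
  -- the length of a known walk yields an exact distance.
  shortest : ∀ {E} {u v : Fin n} {k} → Walk E u v k → ∃ λ d → d ≤ k × IsDist E u v d
  shortest {E} {u} {v} {k} w = least (walk? E u v) k w

  _∷ʳʷ_ : ∀ {E} {u v x : Fin n} {k} → Walk E u v k → Adj E v x → Walk E u x (suc k)
  here     ∷ʳʷ e = step e here
  step f w ∷ʳʷ e = step f (w ∷ʳʷ e)

  reverse-walk : ∀ {E} {u v : Fin n} {k} → Walk E u v k → Walk E v u k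
  reverse-walk here       = here
  reverse-walk (step e w) = reverse-walk w ∷ʳʷ swap e

  walk-⊆ : ∀ {E F} {u v : Fin n} {k} → E ⊆ F → Walk E u v k → Walk F u v k
  walk-⊆ E⊆F here       = here
  walk-⊆ E⊆F (step e w) = step (Sum.map E⊆F E⊆F e) (walk-⊆ E⊆F w)

  walk-lipschitz : ∀ {E} (φ : Fin n → ℕ) → (∀ {u v} → Adj E u v → φ u ≤ suc (φ v)) →
                   ∀ {u v k} → Walk E u v k → φ u ≤ k + φ v
  walk-lipschitz φ lip here       = ≤-refl
  walk-lipschitz φ lip (step e w) = ≤-trans (lip e) (s≤s (walk-lipschitz φ lip w))

-- Labelings as functions of the indices

swap-last : ∀ x y z → x + y + z ≡ x + z + y
swap-last x y z = trans (+-assoc x y z) (trans (cong (x +_) (+-comm y z)) (sym (+-assoc x z y)))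

-- Here n = N + 1, and the vertices have indices 1, …, n. The bounds are the radio conditions of S_{n,s} with the
-- distance of the two vertices moved to the side where no subtraction occurs.
record Separated (N s : ℕ) (c : ℕ → ℕ) : Set where
  field
    positive : ∀ {i} → 1 ≤ i → i ≤ suc N → 1 ≤ c i
    path     : ∀ {i j} → 1 ≤ i → i < j → j ≤ N → N + i ≤ j + ∣ c i - c j ∣
    below    : ∀ {i} → 1 ≤ i → i ≤ s → N + i ≤ suc s + ∣ c (suc N) - c i ∣
    above    : ∀ {i} → s ≤ i → i ≤ N → N + s ≤ suc i + ∣ c (suc N) - c i ∣

-- The leaf takes the position of v_{s-1}, which is within 1 of all its possible neighbours v_{s-2},
-- v_{s-1} and v_s.
folded : ℕ → ℕ → ℕ → ℕ
folded N s i with i ≤? N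
... | yes _ = i
... | no  _ = s ∸ 1

folded-path : ∀ {N s i} → i ≤ N → folded N s i ≡ i
folded-path {N} {s} {i} i≤N with i ≤? N
... | yes _  = refl
... | no i≰N = contradiction i≤N i≰N

folded-leaf : ∀ {N s} → folded N s (suc N) ≡ s ∸ 1
folded-leaf {N} with suc N ≤? N
... | yes N<N = contradiction N<N (<-irrefl refl)
... | no _    = refl

-- The `⊔ 1` keeps the distance of distinct vertices at least 1 although v_n and v_{s-1} are folded
-- together. For n = 2s this decides the label of the leaf.
record Spread (N s : ℕ) (c : ℕ → ℕ) : Set where
  field
    positive : ∀ {i} → 1 ≤ i → i ≤ suc N → 1 ≤ c i
    spread   : ∀ {i j} → 1 ≤ i → i ≤ suc N → 1 ≤ j → j ≤ suc N → i ≢ j →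
               N ≤ (∣ folded N s i - folded N s j ∣ ⊔ 1) + ∣ c i - c j ∣

-- Distances in the family of graphs

-- All graphs of the family are treated at once: explicit walks of the spire bound distances from
-- above, the fold bounds them from below.
module Graph (N s : ℕ) (2≤s : 2 ≤ s) (2s≤n : s + s ≤ suc N) (E : EdgeList)
             (lower : Spire (suc N) s ⊆ E) (upper : E ⊆ Spire12 (suc N) s) where

  n = suc N

  vertex : ∀ {i} → i < n → Fin n
  vertex i<n = fromℕ< i<n

  path-walk : ∀ d (u v : Fin n) → toℕ u + d ≡ toℕ v → suc (toℕ v) < n → Walk (Spire n s) u v d
  path-walk zero u v eq v< with refl ← toℕ-injective (trans (sym (+-identityʳ _)) eq) = here
  path-walk (suc d) u v eq v< = step (inj₁ (there edge)) (path-walk d u⁺ v eq⁺ v<)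
    where
    u<v : toℕ u < toℕ v
    u<v = subst (toℕ u <_) eq (m<m+n (toℕ u) (s≤s z≤n))
    u⁺< = ≤-trans (s≤s u<v) (<⇒≤ v<)
    u⁺ = vertex u⁺<
    edge : (suc (toℕ u) , suc (toℕ u⁺)) ∈ pathEdges n
    edge = subst (λ x → (suc (toℕ u) , suc x) ∈ pathEdges n) (sym (toℕ-fromℕ< u⁺<))
      (∈-applyUpTo⁺ _ (∸-monoˡ-≤ 1 (≤-trans (s≤s u<v) (≤-pred v<))))
    eq⁺ : toℕ u⁺ + d ≡ toℕ v
    eq⁺ = trans (cong (_+ d) (toℕ-fromℕ< u⁺<)) (trans (sym (+-suc (toℕ u) d)) eq)

  leaf : Fin n
  leaf = vertex ≤-refl

  s<N : s < N
  s<N = ≤-pred (≤-trans (+-monoˡ-≤ s 2≤s) 2s≤n)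

  anchor-exists : ∃ λ (a : Fin n) → suc (toℕ a) ≡ s
  anchor-exists with m≤n⇒∃[o]m+o≡n 2≤s
  ... | o , refl = vertex o<n , cong suc (toℕ-fromℕ< o<n)
    where o<n = ≤-trans (n≤1+n _) (≤-trans s<N (n≤1+n N))

  anchor : Fin n
  anchor = proj₁ anchor-exists

  anchor-label : suc (toℕ anchor) ≡ s
  anchor-label = proj₂ anchor-exists

  leaf-label : suc (toℕ leaf) ≡ n
  leaf-label = cong suc (toℕ-fromℕ< ≤-refl)

  leaf-edge : Adj (Spire n s) leaf anchor
  leaf-edge = inj₂ (here (cong₂ _,_ anchor-label leaf-label))

  data Position (v : Fin n) : Set where
    isLeaf : v ≡ leaf → Position v
    onPath : toℕ v < N → Position v

  position : ∀ v → Position v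
  position v with m≤n⇒m<n∨m≡n (≤-pred (toℕ<n v))
  ... | inj₁ v<N = onPath v<N
  ... | inj₂ v≡N = isLeaf (toℕ-injective (trans v≡N (sym (toℕ-fromℕ< ≤-refl))))

  below-walk : ∀ d v → toℕ v + d ≡ toℕ anchor → Walk (Spire n s) leaf v (suc d)
  below-walk d v eq = step leaf-edge (reverse-walk (path-walk d v anchor eq
    (subst (_< n) (sym anchor-label) (≤-trans s<N (n≤1+n N)))))

  above-walk : ∀ d v → toℕ v < N → toℕ anchor + d ≡ toℕ v → Walk (Spire n s) leaf v (suc d)
  above-walk d v v<N eq = step leaf-edge (path-walk d anchor v eq (s≤s v<N))

  ShortWalk : Fin n → Fin n → Set
  ShortWalk u v = ∃ λ d → d ≤ N ∸ 1 × Walk (Spire n s) u v d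

  reverse-short : ∀ {u v} → ShortWalk u v → ShortWalk v u
  reverse-short (d , d≤ , w) = d , d≤ , reverse-walk w

  path-short : ∀ {u v} → toℕ u ≤ toℕ v → toℕ v < N → ShortWalk u v
  path-short {u} {v} u≤v v<N with m≤n⇒∃[o]m+o≡n u≤v
  ... | d , eq = d , ≤-trans (m≤n+m d (toℕ u)) (≤-trans (≤-reflexive eq) (∸-monoˡ-≤ 1 v<N))
               , path-walk d u v eq (s≤s v<N)

  leaf-short : ∀ {v} → toℕ v < N → ShortWalk leaf v
  leaf-short {v} v<N with ≤-total (toℕ v) (toℕ anchor)
  ... | inj₁ v≤a with m≤n⇒∃[o]m+o≡n v≤a
  ...   | d , eq = suc d , ∸-monoˡ-≤ 1 (≤-trans (s≤s (s≤s (≤-trans (m≤n+m d (toℕ v)) (≤-reflexive eq))))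
                     (subst (λ x → suc x ≤ N) (sym anchor-label) s<N))
                 , below-walk d v eq
  leaf-short {v} v<N | inj₂ a≤v with m≤n⇒∃[o]m+o≡n a≤v
  ...   | d , eq = suc d , ∸-monoˡ-≤ 1 (≤-trans (s≤s (≤-trans (+-monoˡ-≤ d (≤-pred (subst (2 ≤_) (sym anchor-label) 2≤s))) (≤-reflexive eq))) v<N)
                 , above-walk d v v<N eq

  short : ∀ u v → ShortWalk u v
  short u v with position u | position v
  ... | isLeaf refl | isLeaf refl = 0 , z≤n , here
  ... | isLeaf refl | onPath v<N  = leaf-short v<N
  ... | onPath u<N  | isLeaf refl = reverse-short (leaf-short u<N)
  ... | onPath u<N  | onPath v<N with ≤-total (toℕ u) (toℕ v)
  ...   | inj₁ u≤v = path-short u≤v v<N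
  ...   | inj₂ v≤u = reverse-short (path-short v≤u u<N)

  short-dist : ∀ {u v d} → IsDist E u v d → d ≤ N ∸ 1
  short-dist {u} {v} (_ , shortest-d) with short u v
  ... | d′ , d′≤ , w = ≤-trans (shortest-d d′ (walk-⊆ lower w)) d′≤

  fold : Fin n → ℕ
  fold v = folded N s (suc (toℕ v))

  Close : ℕ → ℕ → Set
  Close i j = folded N s i ≤ suc (folded N s j) × folded N s j ≤ suc (folded N s i)

  leaf-close : ∀ {i} → i ≤ N → i ≤ s → s ∸ 2 ≤ i → Close i n
  leaf-close {i} i≤N i≤s s-2≤i =
    subst₂ (λ a b → a ≤ suc b × b ≤ suc a) (sym (folded-path i≤N)) (sym (folded-leaf {N} {s}))
      ( ≤-trans i≤s (m≤n+m∸n s 1)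
      , ≤-trans (∸-monoˡ-≤ 1 (m≤n+m∸n s 1)) (≤-trans (m≤n+m∸n (s ∸ 1) 1) (s≤s (≤-trans (≤-reflexive (∸-+-assoc s 1 1)) s-2≤i))))

  edge-close : ∀ {i j} → (i , j) ∈ Spire12 n s → Close i j
  edge-close (here refl) = leaf-close (<⇒≤ s<N) ≤-refl (m∸n≤m s 2)
  edge-close (there (here refl)) =
    leaf-close (≤-trans (m∸n≤m s 1) (<⇒≤ s<N)) (m∸n≤m s 1) (∸-monoʳ-≤ s (n≤1+n 1))
  edge-close (there (there (here refl))) =
    leaf-close (≤-trans (m∸n≤m s 2) (<⇒≤ s<N)) (m∸n≤m s 2) ≤-refl
  edge-close (there (there (there e))) with ∈-applyUpTo⁻ _ e
  ... | i , i< , refl =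
    subst₂ (λ a b → a ≤ suc b × b ≤ suc a)
      (sym (folded-path (<⇒≤ 2+i≤N))) (sym (folded-path 2+i≤N)) (≤-trans (n≤1+n _) (n≤1+n _) , ≤-refl)
    where 2+i≤N = ≤-trans (s≤s i<) (≤-reflexive (m+[n∸m]≡n (≤-trans (s≤s z≤n) s<N)))

  adj-fold : ∀ {u v} → Adj E u v → fold u ≤ suc (fold v)
  adj-fold (inj₁ e) = proj₁ (edge-close (upper e))
  adj-fold (inj₂ e) = proj₂ (edge-close (upper e))

  fold-walk : ∀ {u v k} → Walk E u v k → ∣ fold u - fold v ∣ ≤ k
  fold-walk {u} {v} {k} w with ≤-total (fold u) (fold v)
  ... | inj₁ u≤v = subst (_≤ k) (sym (m≤n⇒∣m-n∣≡n∸m u≤v))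
                     (m≤n+o⇒m∸n≤o (fold v) (fold u) (subst (fold v ≤_) (+-comm k _) (walk-lipschitz fold adj-fold (reverse-walk w))))
  ... | inj₂ v≤u = subst (_≤ k) (sym (m≤n⇒∣n-m∣≡n∸m v≤u))
                     (m≤n+o⇒m∸n≤o (fold u) (fold v) (subst (fold u ≤_) (+-comm k _) (walk-lipschitz fold adj-fold w)))

  2≤N : 2 ≤ N
  2≤N = ≤-trans 2≤s (<⇒≤ s<N)

  suc[N∸1]≡N : suc (N ∸ 1) ≡ N
  suc[N∸1]≡N = m+[n∸m]≡n (<⇒≤ 2≤N)

  first-vertex last-vertex : Fin n
  first-vertex = vertex {0} (s≤s z≤n)
  last-vertex  = vertex {N ∸ 1} (s≤s (m∸n≤m N 1))

  diameter : IsDiam n E (N ∸ 1)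
  diameter = (λ _ _ _ → short-dist) , first-vertex , last-vertex , realised
    where
    f≡ : fold first-vertex ≡ 1
    f≡ = folded-path (<⇒≤ 2≤N)
    l≡ : fold last-vertex ≡ N
    l≡ = trans (cong (λ i → folded N s (suc i)) (toℕ-fromℕ< (s≤s (m∸n≤m N 1))))
               (trans (cong (folded N s) suc[N∸1]≡N) (folded-path ≤-refl))
    realised : IsDist E first-vertex last-vertex (N ∸ 1)
    realised with short first-vertex last-vertex
    ... | d , d≤ , w with shortest (walk-⊆ lower w)
    ...   | d′ , d′≤ , dist@(w′ , _) = subst (IsDist E first-vertex last-vertex)
      (≤-antisym (≤-trans d′≤ d≤)
        (≤-trans (≤-reflexive (sym (m≤n⇒∣m-n∣≡n∸m (<⇒≤ 2≤N))))
          (subst₂ (λ a b → ∣ a - b ∣ ≤ d′) f≡ l≡ (fold-walk w′)))) dist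

  -- A longer walk only weakens the inequality, so the explicit spire walks serve without a proof
  -- that they are shortest.
  radio-separated : ∀ {c} → IsRadioLabeling n E c → ∀ {u v d} → Walk (Spire n s) u v d → u ≢ v →
                    N ≤ d + ∣ c u - c v ∣
  radio-separated {c} (_ , radio) {u} {v} w u≢v with shortest (walk-⊆ lower w)
  ... | d′ , d′≤d , dist = ≤-trans (≤-reflexive (sym suc[N∸1]≡N))
    (≤-trans (radio (N ∸ 1) diameter u v u≢v d′ dist) (+-monoˡ-≤ _ d′≤d))

  spread⇒radio : ∀ {c} → Spread N s c → IsRadioLabeling n E (λ v → c (suc (toℕ v)))
  spread⇒radio {c} S = (λ v → Spread.positive S (s≤s z≤n) (toℕ<n v)) , radio
    where
    radio : ∀ D → IsDiam n E D → ∀ u v → u ≢ v → ∀ d → IsDist E u v d →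
            suc D ≤ d + ∣ c (suc (toℕ u)) - c (suc (toℕ v)) ∣
    radio D (_ , _ , _ , D-dist) u v u≢v d (w , _) = ≤-trans (s≤s (short-dist D-dist))
      (≤-trans (≤-reflexive suc[N∸1]≡N)
      (≤-trans (Spread.spread S (s≤s z≤n) (toℕ<n u) (s≤s z≤n) (toℕ<n v)
                 (λ eq → u≢v (toℕ-injective (suc-injective eq))))
               (+-monoˡ-≤ _ (⊔-lub (fold-walk w) (1≤ w)))))
      where
      1≤ : ∀ {d} → Walk E u v d → 1 ≤ d
      1≤ here       = contradiction refl u≢v
      1≤ (step _ _) = s≤s z≤n

  -- Indices start at 1. The value 0 at index 0 and beyond `n` is a filler that no condition of
  -- `Separated` reads.
  extend : (Fin n → ℕ) → ℕ → ℕ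
  extend c zero = 0
  extend c (suc i) with i <? n
  ... | yes i<n = c (vertex i<n)
  ... | no  _   = 0

  extend-label : ∀ c v → extend c (suc (toℕ v)) ≡ c v
  extend-label c v with toℕ v <? n
  ... | yes v<n = cong c (toℕ-injective (toℕ-fromℕ< v<n))
  ... | no v≮n  = contradiction (toℕ<n v) v≮n

  labelled : ∀ {i} → 1 ≤ i → i ≤ n → ∃ λ (v : Fin n) → suc (toℕ v) ≡ i
  labelled {suc i} _ i<n = vertex i<n , cong suc (toℕ-fromℕ< i<n)

  radio⇒separated : ∀ {c} → IsRadioLabeling n E c → Separated N s (extend c)
  radio⇒separated {c} rad@(pos , _) = record
    { positive = positive ; path = path ; below = below ; above = above }
    where
    positive : ∀ {i} → 1 ≤ i → i ≤ n → 1 ≤ extend c i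
    positive 1≤i i≤n with v , refl ← labelled 1≤i i≤n = subst (1 ≤_) (sym (extend-label c v)) (pos v)

    bound : ∀ {u v d a b} → Walk (Spire n s) u v d → u ≢ v → d + a ≡ b →
            N + a ≤ b + ∣ extend c (suc (toℕ u)) - extend c (suc (toℕ v)) ∣
    bound {u} {v} {d} {a} w u≢v refl =
      subst₂ (λ x y → N + a ≤ d + a + ∣ x - y ∣) (sym (extend-label c u)) (sym (extend-label c v))
        (≤-trans (+-monoˡ-≤ a (radio-separated rad w u≢v)) (≤-reflexive (swap-last d _ a)))

    path : ∀ {i j} → 1 ≤ i → i < j → j ≤ N → N + i ≤ j + ∣ extend c i - extend c j ∣
    path 1≤i i<j j≤N
      with u , refl ← labelled 1≤i (≤-trans (<⇒≤ i<j) (≤-trans j≤N (n≤1+n N)))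
         | v , refl ← labelled (≤-trans 1≤i (<⇒≤ i<j)) (≤-trans j≤N (n≤1+n N))
      with d , eq ← m≤n⇒∃[o]m+o≡n (≤-pred (<⇒≤ i<j)) =
      bound (path-walk d u v eq (s≤s j≤N)) (λ { refl → <-irrefl refl i<j })
            (trans (+-suc d _) (cong suc (trans (+-comm d _) eq)))

    leaf≢ : ∀ {v} → toℕ v < N → leaf ≢ v
    leaf≢ v<N refl = <-irrefl (suc-injective leaf-label) v<N

    leaf-bound : ∀ {v d a b} → Walk (Spire n s) leaf v d → toℕ v < N → d + a ≡ b →
                 N + a ≤ b + ∣ extend c n - extend c (suc (toℕ v)) ∣
    leaf-bound {v} {d} {a} {b} w v<N eq =
      subst (λ x → N + a ≤ b + ∣ extend c x - extend c (suc (toℕ v)) ∣) leaf-label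
        (bound w (leaf≢ v<N) eq)

    below : ∀ {i} → 1 ≤ i → i ≤ s → N + i ≤ suc s + ∣ extend c n - extend c i ∣
    below 1≤i i≤s with v , refl ← labelled 1≤i (≤-trans i≤s (≤-trans (<⇒≤ s<N) (n≤1+n N)))
      with d , eq ← m≤n⇒∃[o]m+o≡n i≤s =
      leaf-bound (below-walk d v (suc-injective (trans eq (sym anchor-label))))
                 (≤-trans i≤s (<⇒≤ s<N)) (cong suc (trans (+-comm d _) eq))

    above : ∀ {i} → s ≤ i → i ≤ N → N + s ≤ suc i + ∣ extend c n - extend c i ∣
    above s≤i i≤N with v , refl ← labelled (≤-trans (<⇒≤ 2≤s) s≤i) (≤-trans i≤N (n≤1+n N))
      with d , eq ← m≤n⇒∃[o]m+o≡n s≤i =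
      leaf-bound (above-walk d v i≤N (suc-injective (trans (cong (_+ d) anchor-label) eq)))
                 i≤N (cong suc (trans (+-comm d _) eq))

-- From labelings of the indices back to spans and radio numbers

foldr-⊔-upper : ∀ {n} (c : Fin n → ℕ) vs {v} → v ∈ vs → c v ≤ foldr _⊔_ 0 (map c vs)
foldr-⊔-upper c (v ∷ vs) (here refl) = m≤m⊔n (c v) _
foldr-⊔-upper c (v ∷ vs) (there v∈)  = ≤-trans (foldr-⊔-upper c vs v∈) (m≤n⊔m (c v) _)

foldr-⊔-lub : ∀ {n} (c : Fin n → ℕ) vs {k} → (∀ v → c v ≤ k) → foldr _⊔_ 0 (map c vs) ≤ k
foldr-⊔-lub c []       c≤k = z≤n
foldr-⊔-lub c (v ∷ vs) c≤k = ⊔-lub (c≤k v) (foldr-⊔-lub c vs c≤k)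

-- The lower bound is stated through a single index whose label reaches `value`, so labelings of
-- indices need no span of their own.
record RadioBound (N s : ℕ) : Set where
  field
    value    : ℕ
    attained : ∀ {c} → Separated N s c → ∃ λ i → 1 ≤ i × i ≤ suc N × value ≤ c i
    labeling : ℕ → ℕ
    spread   : Spread N s labeling
    bounded  : ∀ {i} → 1 ≤ i → i ≤ suc N → labeling i ≤ value

radio-number : ∀ {N s E} → 2 ≤ s → s + s ≤ suc N →
               Spire (suc N) s ⊆ E → E ⊆ Spire12 (suc N) s →
               (B : RadioBound N s) → IsRadioNumber (suc N) E (RadioBound.value B)
radio-number {N} {s} {E} 2≤s 2s≤n lower upper B =
  (c , radio , ≤-antisym (foldr-⊔-lub c (allFin n) (λ v → bounded (s≤s z≤n) (toℕ<n v))) (optimal c radio)) , optimal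
  where
  open Graph N s 2≤s 2s≤n E lower upper
  open RadioBound B
  c : Fin n → ℕ
  c v = labeling (suc (toℕ v))
  radio : IsRadioLabeling n E c
  radio = spread⇒radio spread
  optimal : ∀ c → IsRadioLabeling n E c → value ≤ span n c
  optimal c rad with i , 1≤i , i≤n , value≤ ← attained (radio⇒separated rad)
    with v , refl ← labelled 1≤i i≤n =
    ≤-trans (≤-trans value≤ (≤-reflexive (extend-label c v))) (foldr-⊔-upper c (allFin n) (∈-allFin v))

-- Finite sums

Σ< : ℕ → (ℕ → ℕ) → ℕ
Σ< zero    f = 0
Σ< (suc n) f = Σ< n f + f n

Σ<-front : ∀ n f → Σ< (suc n) f ≡ f 0 + Σ< n (f ∘ suc)
Σ<-front zero    f = sym (+-identityʳ (f 0))
Σ<-front (suc n) f = trans (cong (_+ f (suc n)) (Σ<-front n f)) (+-assoc (f 0) _ _)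

Σ<-cong : ∀ n {f g} → (∀ {i} → i < n → f i ≡ g i) → Σ< n f ≡ Σ< n g
Σ<-cong zero    eq = refl
Σ<-cong (suc n) eq = cong₂ _+_ (Σ<-cong n (λ i<n → eq (≤-trans i<n (n≤1+n n)))) (eq ≤-refl)

Σ<-+ : ∀ n f g → Σ< n (λ i → f i + g i) ≡ Σ< n f + Σ< n g
Σ<-+ zero    f g = refl
Σ<-+ (suc n) f g = trans (cong (_+ (f n + g n)) (Σ<-+ n f g)) (interchange (Σ< n f) (Σ< n g) (f n) (g n))
  where
  interchange : ∀ a b c d → a + b + (c + d) ≡ a + c + (b + d)
  interchange = solve-∀

Σ<-mono : ∀ {m n} f → m ≤ n → Σ< m f ≤ Σ< n f
Σ<-mono {m} {n} f m≤n with o , refl ← m≤n⇒∃[o]m+o≡n m≤n = go o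
  where
  go : ∀ o → Σ< m f ≤ Σ< (m + o) f
  go zero    = ≤-reflexive (cong (λ k → Σ< k f) (sym (+-identityʳ m)))
  go (suc o) = ≤-trans (≤-trans (go o) (m≤m+n _ (f (m + o)))) (≤-reflexive (cong (λ k → Σ< k f) (sym (+-suc m o))))

Σ<-pair : ∀ {N i} f → suc i < N → f i + f (suc i) ≤ Σ< N f
Σ<-pair {N} {i} f i< = ≤-trans (+-monoˡ-≤ (f (suc i)) (m≤n+m (f i) (Σ< i f))) (Σ<-mono f i<)

Σ<-append-pair : ∀ {N m i} f → m ≤ i → suc i < N → Σ< m f + (f i + f (suc i)) ≤ Σ< N f
Σ<-append-pair {N} {m} {i} f m≤i i< = ≤-trans (+-monoˡ-≤ (f i + f (suc i)) (Σ<-mono f m≤i))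
  (≤-trans (≤-reflexive (sym (+-assoc (Σ< i f) (f i) (f (suc i))))) (Σ<-mono f i<))

Σ<-append : ∀ {N m i} f → m ≤ i → i < N → Σ< m f + f i ≤ Σ< N f
Σ<-append {N} {m} {i} f m≤i i< = ≤-trans (+-monoˡ-≤ (f i) (Σ<-mono f m≤i)) (Σ<-mono f i<)

-- Sorting the vertices by label

nth : List ℕ → ℕ → ℕ
nth []       _       = 0
nth (x ∷ xs) zero    = x
nth (x ∷ xs) (suc i) = nth xs i

nth-All : ∀ {P : ℕ → Set} {xs i} → All P xs → i < length xs → P (nth xs i)
nth-All {i = zero}  (p All.∷ ps) _         = p
nth-All {i = suc i} (p All.∷ ps) (s≤s i<l) = nth-All ps i<l

nth-AllPairs : ∀ {R : ℕ → ℕ → Set} {xs i j} → AllPairs R xs → i < j → j < length xs → R (nth xs i) (nth xs j)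
nth-AllPairs {i = zero}  {suc j} (r AllPairs.∷ rs) _         (s≤s j<l) = nth-All r j<l
nth-AllPairs {i = suc i} {suc j} (r AllPairs.∷ rs) (s≤s i<j) (s≤s j<l) = nth-AllPairs rs i<j j<l

nth-∈ : ∀ {xs v} → v ∈ xs → ∃ λ i → i < length xs × nth xs i ≡ v
nth-∈ (here refl) = 0 , s≤s z≤n , refl
nth-∈ (there v∈) with i , i<l , eq ← nth-∈ v∈ = suc i , s≤s i<l , eq

sum-nth : ∀ (f : ℕ → ℕ) xs → sum (map f xs) ≡ Σ< (length xs) (f ∘ nth xs)
sum-nth f []       = refl
sum-nth f (x ∷ xs) = trans (cong (f x +_) (sum-nth f xs)) (sym (Σ<-front (length xs) _))

sum-applyUpTo : ∀ (f g : ℕ → ℕ) n → sum (map f (applyUpTo g n)) ≡ Σ< n (f ∘ g)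
sum-applyUpTo f g zero    = refl
sum-applyUpTo f g (suc n) = trans (cong (f (g 0) +_) (sum-applyUpTo f (g ∘ suc) n)) (sym (Σ<-front n (f ∘ g)))

-- The sorted list of vertices as a sequence of places 0, ..., N. `x-total` lets a sum along the
-- order be evaluated in the order of the indices.
record Ordering (N : ℕ) (c : ℕ → ℕ) : Set where
  field
    x           : ℕ → ℕ
    x-positive  : ∀ {i} → i ≤ N → 1 ≤ x i
    x-bounded   : ∀ {i} → i ≤ N → x i ≤ suc N
    x-injective : ∀ {i j} → i < j → j ≤ N → x i ≢ x j
    x-mono      : ∀ {i j} → i < j → j ≤ N → c (x i) ≤ c (x j)
    x-onto      : ∀ {v} → 1 ≤ v → v ≤ suc N → ∃ λ i → i ≤ N × x i ≡ v
    x-total     : ∀ w → Σ< (suc N) (w ∘ x) ≡ Σ< (suc N) (w ∘ suc)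

abstract
  ordering : ∀ N c → Ordering N c
  ordering N c = record
    { x           = nth xs
    ; x-positive  = λ i≤N → proj₁ (range i≤N)
    ; x-bounded   = λ i≤N → proj₂ (range i≤N)
    ; x-injective = λ i<j j≤N → nth-AllPairs distinct i<j (in-range j≤N)
    ; x-mono      = λ i<j j≤N → nth-AllPairs sorted i<j (in-range j≤N)
    ; x-onto      = onto
    ; x-total     = λ w → trans (cong (λ l → Σ< l (w ∘ nth xs)) (sym length-xs))
                          (trans (sym (sum-nth w xs)) (trans (sum-↭ (map⁺ w xs↭)) (sum-applyUpTo w suc (suc N))))
    }
    where
    byLabel : DecTotalOrder 0ℓ 0ℓ 0ℓ
    byLabel = On.decTotalOrder ≤-decTotalOrder c
    open Data.List.Sort byLabel using (sort; sort-↭; sort-↗)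
    indices xs : List ℕ
    indices = applyUpTo suc (suc N)
    xs = sort indices
    xs↭ : xs ↭ indices
    xs↭ = sort-↭ indices
    length-xs : length xs ≡ suc N
    length-xs = trans (↭-length xs↭) (length-applyUpTo suc (suc N))
    in-range : ∀ {i} → i ≤ N → i < length xs
    in-range i≤N = ≤-trans (s≤s i≤N) (≤-reflexive (sym length-xs))
    range : ∀ {i} → i ≤ N → 1 ≤ nth xs i × nth xs i ≤ suc N
    range i≤N = nth-All (All.tabulate member) (in-range i≤N)
      where
      member : ∀ {v} → v ∈ xs → 1 ≤ v × v ≤ suc N
      member v∈ with i , i< , refl ← ∈-applyUpTo⁻ suc (∈-resp-↭ xs↭ v∈) = s≤s z≤n , i<
    sorted : AllPairs (λ u v → c u ≤ c v) xs
    sorted = Sorted⇒AllPairs (DecTotalOrder.totalOrder byLabel) (sort-↗ indices)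
    distinct : Unique xs
    distinct = PermutationSetoid.Unique-resp-↭ (setoid ℕ) (↭⇒↭ₛ (↭-sym xs↭))
      (applyUpTo⁺₁ suc (suc N) (λ i<j _ eq → <-irrefl (suc-injective eq) i<j))
    onto : ∀ {v} → 1 ≤ v → v ≤ suc N → ∃ λ i → i ≤ N × nth xs i ≡ v
    onto {suc v} _ v≤ with i , i<l , eq ← nth-∈ (∈-resp-↭ (↭-sym xs↭) (∈-applyUpTo⁺ suc v≤)) =
      i , ≤-pred (subst (i <_) length-xs i<l) , eq

-- The slack of a labeling

-- Certificates for linear inequalities: the hypotheses are added up to `a ≤ b`, `r` is the surplus,
-- and what remains is an identity for the ring solver.
≤-by : ∀ {a b p q} r → a ≤ b → q + a ≡ p + b + r → p ≤ q
≤-by {a} {b} {p} {q} r a≤b eq = +-cancelʳ-≤ a p q (begin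
  p + a      ≤⟨ +-monoʳ-≤ p a≤b ⟩
  p + b      ≤⟨ m≤m+n (p + b) r ⟩
  p + b + r  ≡⟨ sym eq ⟩
  q + a      ∎)
  where open ≤-Reasoning

module Gaps {N c} (O : Ordering N c) (M : ℕ) (w : ℕ → ℕ) where

  open Ordering O public

  -- `slack i` is the excess of a gap over the least one that the weights of its two vertices
  -- permit; `slack-spec` shows that the subtraction is never truncated.
  gap slack : ℕ → ℕ
  gap i   = ∣ c (x i) - c (x (suc i)) ∣
  slack i = (gap i + w (x i) + w (x (suc i))) ∸ M

-- M and w encode the upper bound w u + w v + (N - M) for the distance of u and v, the diameter being N - 1.
module Slack {N c} (O : Ordering N c) (M : ℕ) (w : ℕ → ℕ)
  (steep : ∀ {u v} → 1 ≤ u → u ≤ suc N → 1 ≤ v → v ≤ suc N → u ≢ v → M ≤ ∣ c u - c v ∣ + w u + w v) where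

  open Gaps O M w public

  slack-spec : ∀ {i} → i < N → slack i + M ≡ gap i + w (x i) + w (x (suc i))
  slack-spec i<N = m∸n+n≡m (steep (x-positive (<⇒≤ i<N)) (x-bounded (<⇒≤ i<N))
    (x-positive i<N) (x-bounded i<N) (x-injective ≤-refl i<N))

  label-step : ∀ {i} → i < N → c (x i) + gap i ≡ c (x (suc i))
  label-step {i} i<N = trans (cong (c (x i) +_) (m≤n⇒∣m-n∣≡n∸m le)) (m+[n∸m]≡n le)
    where le = x-mono ≤-refl i<N

  gap-+ : ∀ {i} → suc i < N → ∣ c (x i) - c (x (2 + i)) ∣ ≡ gap i + gap (suc i)
  gap-+ {i} 1+i<N = trans (cong (λ y → ∣ c (x i) - y ∣) two-steps) (∣m-m+n∣≡n (c (x i)) _)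
    where
    two-steps : c (x (2 + i)) ≡ c (x i) + (gap i + gap (suc i))
    two-steps = trans (sym (label-step 1+i<N)) (trans (cong (_+ gap (suc i)) (sym (label-step (<⇒≤ 1+i<N)))) (+-assoc (c (x i)) _ _))

  -- The gaps telescope. Summing the slack equations counts inner weights twice and the two end
  -- weights once; adding the end weights again completes twice the full sum.
  telescope : ∀ m → m ≤ N → c (x 0) + m * M + Σ< m slack + w (x 0) + w (x m) ≡ c (x m) + 2 * Σ< (suc m) (w ∘ x)
  telescope zero    _   = base (c (x 0)) (w (x 0))
    where
    base : ∀ a b → a + 0 + 0 + b + b ≡ a + 2 * (0 + b)
    base = solve-∀
  telescope (suc m) m<N = +-cancelʳ-≡ (w (x m) + gap m) _ _
    (advance (c (x 0)) m M (Σ< m slack) (slack m) (w (x 0)) (w (x m)) (w (x (suc m))) (c (x m)) (c (x (suc m))) (gap m) (Σ< (suc m) (w ∘ x))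
      (telescope m (<⇒≤ m<N)) (slack-spec m<N) (label-step m<N))
    where
    advance : ∀ a m M S f w₀ w₁ w₂ c₁ c₂ g W → a + m * M + S + w₀ + w₁ ≡ c₁ + 2 * W → f + M ≡ g + w₁ + w₂ → c₁ + g ≡ c₂ →
           a + suc m * M + (S + f) + w₀ + w₂ + (w₁ + g) ≡ c₂ + 2 * (W + w₂) + (w₁ + g)
    advance a m M S f w₀ w₁ w₂ c₁ c₂ g W e₁ e₂ refl = begin
      a + suc m * M + (S + f) + w₀ + w₂ + (w₁ + g)       ≡⟨ before a m M S f w₀ w₁ w₂ g ⟩
      (a + m * M + S + w₀ + w₁) + (f + M) + (w₂ + g)     ≡⟨ cong₂ (λ p q → p + q + (w₂ + g)) e₁ e₂ ⟩
      (c₁ + 2 * W) + (g + w₁ + w₂) + (w₂ + g)            ≡⟨ after c₁ W g w₁ w₂ ⟩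
      c₁ + g + 2 * (W + w₂) + (w₁ + g)                   ∎
      where
      open ≡-Reasoning
      before : ∀ a m M S f w₀ w₁ w₂ g →
               a + suc m * M + (S + f) + w₀ + w₂ + (w₁ + g) ≡ (a + m * M + S + w₀ + w₁) + (f + M) + (w₂ + g)
      before = solve-∀
      after : ∀ c W g w₁ w₂ → (c + 2 * W) + (g + w₁ + w₂) + (w₂ + g) ≡ c + g + 2 * (W + w₂) + (w₁ + g)
      after = solve-∀

  -- The total weight does not depend on the order, so the last label is determined by the first
  -- label, the slack and the end weights. The equation for `T` carries `W₂` on the left to avoid
  -- subtraction.
  last-label : ∀ {T δ W₂} → 1 ≤ c (x 0) → δ ≤ Σ< N slack + w (x 0) + w (x N) → 2 * Σ< (suc N) (w ∘ suc) ≡ W₂ →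
               T + W₂ ≡ 1 + N * M + δ → T ≤ c (x N)
  last-label {T} {δ} {W₂} 1≤c δ≤ weights eq = +-cancelʳ-≤ W₂ T (c (x N)) (begin
    T + W₂                                                  ≡⟨ eq ⟩
    1 + N * M + δ                                           ≤⟨ +-mono-≤ (+-monoˡ-≤ (N * M) 1≤c) δ≤ ⟩
    c (x 0) + N * M + (Σ< N slack + w (x 0) + w (x N))      ≡⟨ regroup (c (x 0)) (N * M) (Σ< N slack) (w (x 0)) (w (x N)) ⟩
    c (x 0) + N * M + Σ< N slack + w (x 0) + w (x N)        ≡⟨ telescope N ≤-refl ⟩
    c (x N) + 2 * Σ< (suc N) (w ∘ x)                        ≡⟨ cong (λ y → c (x N) + 2 * y) (x-total w) ⟩
    c (x N) + 2 * Σ< (suc N) (w ∘ suc)                      ≡⟨ cong (c (x N) +_) weights ⟩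
    c (x N) + W₂                                            ∎)
    where
    open ≤-Reasoning
    regroup : ∀ a b s p q → a + b + (s + p + q) ≡ a + b + s + p + q
    regroup = solve-∀

-- Lower bounds

-- Truncation kills all terms from the `q`-th on, which leaves a triangular number; doubling avoids
-- its denominator.
Σ<-descending : ∀ q r → 2 * Σ< (q + r) (q ∸_) ≡ q * suc q
Σ<-descending zero    r = zeros r
  where
  zeros : ∀ r → 2 * Σ< r (0 ∸_) ≡ 0
  zeros zero    = refl
  zeros (suc r) = trans (cong (λ y → 2 * (Σ< r (0 ∸_) + y)) (0∸n≡0 r))
                        (trans (cong (2 *_) (+-identityʳ (Σ< r (0 ∸_)))) (zeros r))
Σ<-descending (suc q) r = begin
  2 * Σ< (suc (q + r)) (suc q ∸_)       ≡⟨ cong (2 *_) (Σ<-front (q + r) (suc q ∸_)) ⟩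
  2 * (suc q + Σ< (q + r) (q ∸_))       ≡⟨ *-distribˡ-+ 2 (suc q) _ ⟩
  2 * suc q + 2 * Σ< (q + r) (q ∸_)     ≡⟨ cong (2 * suc q +_) (Σ<-descending q r) ⟩
  2 * suc q + q * suc q                 ≡⟨ *-distribʳ-+ (suc q) 2 q ⟨
  (2 + q) * suc q                       ≡⟨ *-comm (2 + q) (suc q) ⟩
  suc q * (2 + q)                       ∎
  where open ≡-Reasoning

Σ<-ascending : ∀ q t → 2 * Σ< (q + suc t) (_∸ q) ≡ t * suc t
Σ<-ascending zero zero    = refl
Σ<-ascending zero (suc t) = begin
  2 * (Σ< (suc t) (_∸ 0) + suc t)       ≡⟨ *-distribˡ-+ 2 (Σ< (suc t) (_∸ 0)) (suc t) ⟩
  2 * Σ< (suc t) (_∸ 0) + 2 * suc t     ≡⟨ cong (_+ 2 * suc t) (Σ<-ascending 0 t) ⟩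
  t * suc t + 2 * suc t                 ≡⟨ *-distribʳ-+ (suc t) t 2 ⟨
  (t + 2) * suc t                       ≡⟨ *-comm (t + 2) (suc t) ⟩
  suc t * (t + 2)                       ≡⟨ cong (suc t *_) (+-comm t 2) ⟩
  suc t * (2 + t)                       ∎
  where open ≡-Reasoning
Σ<-ascending (suc q) t = trans (cong (2 *_) (Σ<-front (q + suc t) (_∸ suc q))) (Σ<-ascending q t)

-- The weight of a vertex is its distance from the middle vertices a ≤ b of the path, ℓ that of the leaf.
weight : (N a b ℓ v : ℕ) → ℕ
weight N a b ℓ v with v ≤? N
... | yes _ = (a ∸ v) + (v ∸ b)
... | no  _ = ℓ

weight-path : ∀ {N a b ℓ v} → v ≤ N → weight N a b ℓ v ≡ (a ∸ v) + (v ∸ b)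
weight-path {N} {v = v} v≤N with v ≤? N
... | yes _  = refl
... | no v≰N = contradiction v≤N v≰N

weight-leaf : ∀ {N a b ℓ} → weight N a b ℓ (suc N) ≡ ℓ
weight-leaf {N} with suc N ≤? N
... | yes N<N = contradiction N<N (<-irrefl refl)
... | no _    = refl

weight-zero : ∀ {N a b ℓ v} → weight N a b (suc ℓ) v ≡ 0 → a ≤ v × v ≤ b
weight-zero {N} {a} {v = v} w≡0 with v ≤? N
weight-zero {N} {a} {v = v} w≡0 | yes _ = m∸n≡0⇒m≤n (m+n≡0⇒m≡0 (a ∸ v) w≡0) , m∸n≡0⇒m≤n (m+n≡0⇒n≡0 (a ∸ v) w≡0)
weight-zero {N} {a} {v = v} ()  | no _

-- Here v_s is at distance e from the middle vertices s + e and b.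
module Weighted {N s c} (sep : Separated N s c) (e b M δ : ℕ) (b≤a+δ : b ≤ s + e + δ) (M+δ≡N : M + δ ≡ N) where

  open Separated sep

  a : ℕ
  a = s + e

  w : ℕ → ℕ
  w = weight N (s + e) b (suc e)

  w-path : ∀ {v} → v ≤ N → w v ≡ (a ∸ v) + (v ∸ b)
  w-path = weight-path

  w-leaf : w (suc N) ≡ suc e
  w-leaf = weight-leaf {N}

  w-zero : ∀ {v} → w v ≡ 0 → a ≤ v × v ≤ b
  w-zero = weight-zero {N}

  -- Each arm of the path contributes one of the two truncated differences, hence a triangular
  -- number, and the leaf contributes `suc e`.
  total-weight : ∀ {a′ b′ r t} → a ≡ suc a′ → b ≡ suc b′ → N ≡ a′ + r → N ≡ b′ + suc t →
                 2 * Σ< (suc N) (w ∘ suc) ≡ a′ * suc a′ + t * suc t + 2 * suc e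
  total-weight {a′} {b′} {r} {t} a≡ b≡ N≡₁ N≡₂ = begin
    2 * (Σ< N (w ∘ suc) + w (suc N))                             ≡⟨ *-distribˡ-+ 2 (Σ< N (w ∘ suc)) (w (suc N)) ⟩
    2 * Σ< N (w ∘ suc) + 2 * w (suc N)                           ≡⟨ cong₂ (λ y z → 2 * y + 2 * z) path-sum w-leaf ⟩
    2 * (Σ< N (a′ ∸_) + Σ< N (_∸ b′)) + 2 * suc e                ≡⟨ cong (_+ 2 * suc e) (*-distribˡ-+ 2 (Σ< N (a′ ∸_)) _) ⟩
    2 * Σ< N (a′ ∸_) + 2 * Σ< N (_∸ b′) + 2 * suc e              ≡⟨ cong₂ (λ y z → 2 * Σ< y (a′ ∸_) + 2 * Σ< z (_∸ b′) + 2 * suc e) N≡₁ N≡₂ ⟩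
    2 * Σ< (a′ + r) (a′ ∸_) + 2 * Σ< (b′ + suc t) (_∸ b′) + 2 * suc e
      ≡⟨ cong₂ (λ y z → y + z + 2 * suc e) (Σ<-descending a′ r) (Σ<-ascending b′ t) ⟩
    a′ * suc a′ + t * suc t + 2 * suc e                          ∎
    where
    open ≡-Reasoning
    path-sum : Σ< N (w ∘ suc) ≡ Σ< N (a′ ∸_) + Σ< N (_∸ b′)
    path-sum = trans (Σ<-cong N (λ {i} i<N → trans (w-path i<N) (cong₂ (λ y z → (y ∸ suc i) + (suc i ∸ z)) a≡ b≡)))
                     (Σ<-+ N (a′ ∸_) (_∸ b′))

  Steep : ℕ → ℕ → Set
  Steep u v = M ≤ ∣ c u - c v ∣ + w u + w v

  steep-sym : ∀ {u v} → Steep v u → Steep u v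
  steep-sym {u} {v} st = subst (M ≤_) (trans (cong (λ d → d + w v + w u) (∣-∣-comm (c v) (c u)))
                                             (swap-last ∣ c u - c v ∣ (w v) (w u))) st

  -- The stretch from u to v consists of at most `a ∸ u` steps before `a`, `v ∸ b` steps after `b`
  -- and the `δ = N - M` steps between them.
  steep-path : ∀ {u v} → 1 ≤ u → u < v → v ≤ N → Steep u v
  steep-path {u} {v} 1≤u u<v v≤N =
    subst₂ (λ y z → M ≤ ∣ c u - c v ∣ + y + z) (sym (w-path (≤-trans (<⇒≤ u<v) v≤N))) (sym (w-path v≤N))
      (≤-by _ (+-mono-≤ (+-mono-≤ (path 1≤u u<v v≤N) (≤-reflexive M+δ≡N))
                        (+-mono-≤ b≤a+δ (+-mono-≤ (m≤n+m∸n a u) (m≤n+m∸n v b))))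
        (certificate M N δ a b u v ∣ c u - c v ∣ (a ∸ u) (u ∸ b) (a ∸ v) (v ∸ b)))
    where
    certificate : ∀ M N δ a b u v d au ub av vb →
      d + (au + ub) + (av + vb) + (N + u + (M + δ) + (b + (a + v)))
      ≡ M + (v + d + N + (a + δ + (u + au + (b + vb)))) + (ub + av)
    certificate = solve-∀

  steep-leaf : ∀ {v} → 1 ≤ v → v ≤ N → Steep (suc N) v
  steep-leaf {v} 1≤v v≤N =
    subst₂ (λ y z → M ≤ ∣ c (suc N) - c v ∣ + y + z) (sym w-leaf) (sym (w-path v≤N)) bound
    where
    d = ∣ c (suc N) - c v ∣
    bound : M ≤ d + suc e + ((a ∸ v) + (v ∸ b))
    bound with ≤-total v s
    -- The surplus contains `2 * e`: the route through the middle runs from v_s to the middle and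
    -- back.
    ... | inj₁ v≤s = ≤-by _ (+-mono-≤ (+-mono-≤ (below 1≤v v≤s) (≤-reflexive M+δ≡N)) (m≤n+m∸n a v))
                            (certificate M N δ s e v d (a ∸ v) (v ∸ b))
      where
      certificate : ∀ M N δ s e v d av vb → d + suc e + (av + vb) + (N + v + (M + δ) + (s + e))
        ≡ M + (suc s + d + N + (v + av)) + (δ + 2 * e + vb)
      certificate = solve-∀
    ... | inj₂ s≤v = ≤-by _ (+-mono-≤ (+-mono-≤ (above s≤v v≤N) (≤-reflexive M+δ≡N)) (+-mono-≤ b≤a+δ (m≤n+m∸n v b)))
                            (certificate M N δ s e b v d (a ∸ v) (v ∸ b))
      where
      certificate : ∀ M N δ s e b v d av vb → d + suc e + (av + vb) + (N + s + (M + δ) + (b + v))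
        ≡ M + (suc v + d + N + (s + e + δ + (b + vb))) + av
      certificate = solve-∀

  steep : ∀ {u v} → 1 ≤ u → u ≤ suc N → 1 ≤ v → v ≤ suc N → u ≢ v → Steep u v
  steep {u} {v} 1≤u u≤ 1≤v v≤ u≢v with m≤n⇒m<n∨m≡n u≤ | m≤n⇒m<n∨m≡n v≤
  ... | inj₂ refl | inj₂ refl = contradiction refl u≢v
  ... | inj₂ refl | inj₁ v<   = steep-leaf 1≤v (≤-pred v<)
  ... | inj₁ u<   | inj₂ refl = steep-sym {u} (steep-leaf 1≤u (≤-pred u<))
  ... | inj₁ u<   | inj₁ v<   with <-cmp u v
  ...   | tri< u<v _ _ = steep-path 1≤u u<v (≤-pred v<)
  ...   | tri≈ _ u≡v _ = contradiction u≡v u≢v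
  ...   | tri> _ _ v<u = steep-sym {u} (steep-path 1≤v v<u (≤-pred u<))

  open Slack (ordering N c) M w steep public

  total-slack : ℕ
  total-slack = Σ< N slack + w (x 0) + w (x N)

  w₀≤total : w (x 0) ≤ total-slack
  w₀≤total = ≤-trans (m≤n+m (w (x 0)) (Σ< N slack)) (m≤m+n _ (w (x N)))

  wₙ≤total : w (x N) ≤ total-slack
  wₙ≤total = m≤n+m (w (x N)) _

  slacks≤total : Σ< N slack ≤ total-slack
  slacks≤total = ≤-trans (m≤m+n _ (w (x 0))) (m≤m+n _ (w (x N)))

  attained : ∀ {T a′ b′ r t} Δ → a ≡ suc a′ → b ≡ suc b′ → N ≡ a′ + r → N ≡ b′ + suc t → Δ ≤ total-slack →
             T + (a′ * suc a′ + t * suc t + 2 * suc e) ≡ 1 + N * M + Δ →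
             ∃ λ i → 1 ≤ i × i ≤ suc N × T ≤ c i
  attained Δ a≡ b≡ N≡₁ N≡₂ Δ≤ eq = x N , x-positive ≤-refl , x-bounded ≤-refl ,
    last-label (positive (x-positive z≤n) (x-bounded z≤n)) Δ≤ (total-weight a≡ b≡ N≡₁ N≡₂) eq

-- Slack with one middle vertex

module OneMiddle {N s c} (sep : Separated N s c) (e : ℕ) (0<N : 0 < N) where

  open Weighted sep e (s + e) N 0 (≤-reflexive (sym (+-identityʳ _))) (+-identityʳ N) public

  middle : ∀ {v} → w v ≡ 0 → v ≡ s + e
  middle w≡0 = ≤-antisym (proj₂ (w-zero w≡0)) (proj₁ (w-zero w≡0))

  positive-slack : 1 ≤ total-slack
  positive-slack with w (x 0) ≟ 0 | w (x N) ≟ 0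
  ... | no w₀≢0  | _        = ≤-trans (n≢0⇒n>0 w₀≢0) w₀≤total
  ... | yes _    | no wₙ≢0  = ≤-trans (n≢0⇒n>0 wₙ≢0) wₙ≤total
  ... | yes w₀≡0 | yes wₙ≡0 = contradiction (trans (middle w₀≡0) (sym (middle wₙ≡0))) (x-injective 0<N ≤-refl)

-- Slack with two middle vertices

module TwoMiddles {s e c} (sep : Separated (suc (s + e + (s + e))) s c) (2≤s : 2 ≤ s) where

  j N M : ℕ
  j = s + e
  M = j + j
  N = suc M

  open Separated sep using (path; below; above)
  open Weighted sep e (suc j) M 1 (≤-reflexive (+-comm 1 j)) (+-comm M 1) public

  2≤j : 2 ≤ j
  2≤j = ≤-trans 2≤s (m≤m+n s e)

  -- The two sides of the middle edge; the last index is the weight.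
  data Place : Bool → ℕ → ℕ → Set where
    left  : ∀ {v r} → 1 ≤ v → r + v ≡ j → Place false v r
    leaf  : Place false (suc N) (suc e)
    right : ∀ {v r} → v ≤ N → r + suc j ≡ v → Place true v r

  place : ∀ {v} → 1 ≤ v → v ≤ suc N → ∃ λ side → Place side v (w v)
  place {v} 1≤v v≤ with m≤n⇒m<n∨m≡n v≤
  ... | inj₂ refl = false , subst (Place false v) (sym w-leaf) leaf
  ... | inj₁ v<   with v ≤? j
  ...   | yes v≤j = false , left 1≤v (begin
            w v + v                      ≡⟨ cong (_+ v) (w-path (≤-pred v<)) ⟩
            (j ∸ v) + (v ∸ suc j) + v    ≡⟨ cong (λ y → (j ∸ v) + y + v) (m≤n⇒m∸n≡0 (≤-trans v≤j (n≤1+n j))) ⟩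
            (j ∸ v) + 0 + v              ≡⟨ cong (_+ v) (+-identityʳ (j ∸ v)) ⟩
            (j ∸ v) + v                  ≡⟨ m∸n+n≡m v≤j ⟩
            j                            ∎)
    where open ≡-Reasoning
  ...   | no v≰j = true , right (≤-pred v<) (begin
            w v + suc j                      ≡⟨ cong (_+ suc j) (w-path (≤-pred v<)) ⟩
            (j ∸ v) + (v ∸ suc j) + suc j    ≡⟨ cong (λ y → y + (v ∸ suc j) + suc j) (m≤n⇒m∸n≡0 (<⇒≤ (≰⇒> v≰j))) ⟩
            (v ∸ suc j) + suc j              ≡⟨ m∸n+n≡m (≰⇒> v≰j) ⟩
            v                                ∎)
    where open ≡-Reasoning

  place-functional : ∀ {b b′ v r r′} → Place b v r → Place b′ v r′ → b ≡ b′ × r ≡ r′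
  place-functional (left {v} _ e₁) (left _ e₂)  = refl , +-cancelʳ-≡ v _ _ (trans e₁ (sym e₂))
  place-functional (left {r = r} _ e₁) leaf     = contradiction (≤-trans (m≤n+m _ r) (≤-reflexive e₁)) (<⇒≱ (s≤s (≤-trans (m≤m+n j j) (n≤1+n _))))
  place-functional (left {v} {r} _ e₁) (right {r = r′} _ e₂) = contradiction (≤-trans (≤-trans (m≤n+m _ r′) (≤-reflexive e₂)) (≤-trans (m≤n+m v r) (≤-reflexive e₁))) (<-irrefl refl)
  place-functional leaf leaf = refl , refl
  place-functional leaf (left {r = r} _ e₁) = contradiction (≤-trans (m≤n+m _ r) (≤-reflexive e₁)) (<⇒≱ (s≤s (≤-trans (m≤m+n j j) (n≤1+n _))))
  place-functional leaf (right v≤N _) = contradiction v≤N (<-irrefl refl)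
  place-functional (right v≤N _) leaf = contradiction v≤N (<-irrefl refl)
  place-functional (right {r = r′} _ e₂) (left {v} {r} _ e₁) = contradiction (≤-trans (≤-trans (m≤n+m _ r′) (≤-reflexive e₂)) (≤-trans (m≤n+m v r) (≤-reflexive e₁))) (<-irrefl refl)
  place-functional (right _ e₁) (right _ e₂) = refl , +-cancelʳ-≡ (suc j) _ _ (trans e₁ (sym e₂))

  weight≤j : ∀ {b v r} → Place b v r → r ≤ j
  weight≤j (left {v} {r} _ e₁)  = ≤-trans (m≤m+n r v) (≤-reflexive e₁)
  weight≤j leaf                 = +-monoˡ-≤ e (<⇒≤ 2≤s)
  weight≤j (right {v} {r} v≤N e₁) = +-cancelʳ-≤ (suc j) r j (≤-trans (≤-reflexive e₁) (≤-trans v≤N (≤-reflexive (sym (+-suc j j)))))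

  -- The overlap m of the routes from u and v to the middle makes w u + w v + 1 exceed
  -- the distance of u and v by 1 + 2 m.
  SameSide : ℕ → ℕ → ℕ → ℕ → Set
  SameSide u r v t = ∃ λ m → (m ≡ r ⊎ m ≡ t ⊎ m ≡ e) × 1 + 2 * m + M ≤ ∣ c u - c v ∣ + r + t

  sameSide-sym : ∀ {u r v t} → SameSide v t u r → SameSide u r v t
  sameSide-sym {u} {r} {v} {t} (m , m∈ , le) = m , flip m∈ ,
    ≤-trans le (≤-reflexive (trans (cong (λ d → d + t + r) (∣-∣-comm (c v) (c u))) (swap-last ∣ c u - c v ∣ t r)))
    where
    flip : m ≡ t ⊎ m ≡ r ⊎ m ≡ e → m ≡ r ⊎ m ≡ t ⊎ m ≡ e
    flip (inj₁ p)        = inj₂ (inj₁ p)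
    flip (inj₂ (inj₁ p)) = inj₁ p
    flip (inj₂ (inj₂ p)) = inj₂ (inj₂ p)

  sameSide-left : ∀ {u r v t} → 1 ≤ u → u < v → v ≤ N → r + u ≡ j → t + v ≡ j → SameSide u r v t
  sameSide-left {u} {r} {v} {t} 1≤u u<v v≤N r+u t+v = t , inj₂ (inj₁ refl) ,
    ≤-by 0 (+-mono-≤ (path 1≤u u<v v≤N) (+-mono-≤ (≤-reflexive (sym r+u)) (≤-reflexive t+v)))
         (certificate ∣ c u - c v ∣ j u v r t)
    where
    certificate : ∀ d j u v r t → d + r + t + (suc (j + j) + u + (j + (t + v)))
                                ≡ 1 + 2 * t + (j + j) + (v + d + (r + u + j)) + 0
    certificate = solve-∀

  sameSide-right : ∀ {u r v t} → u < v → v ≤ N → r + suc j ≡ u → t + suc j ≡ v → SameSide u r v t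
  sameSide-right {u} {r} {v} {t} u<v v≤N r+j t+j = r , inj₁ refl ,
    ≤-by 0 (+-mono-≤ (path 1≤u u<v v≤N) (+-mono-≤ (≤-reflexive r+j) (≤-reflexive (sym t+j))))
         (certificate ∣ c u - c v ∣ j u v r t)
    where
    1≤u = ≤-trans (≤-trans (s≤s z≤n) (m≤n+m (suc j) r)) (≤-reflexive r+j)
    certificate : ∀ d j u v r t → d + r + t + (suc (j + j) + u + (r + suc j + v))
                                ≡ 1 + 2 * r + (j + j) + (v + d + (u + (t + suc j))) + 0
    certificate = solve-∀

  -- The route of the leaf joins the path at v_s. Before v_s the two routes share the `e` steps from
  -- v_s to the middle; from v_s on they share the whole route of v.
  sameSide-leaf : ∀ {v t} → 1 ≤ v → t + v ≡ j → SameSide (suc N) (suc e) v t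
  sameSide-leaf {v} {t} 1≤v t+v with ≤-total v s
  ... | inj₁ v≤s = e , inj₂ (inj₂ refl) ,
    ≤-by 0 (+-mono-≤ (below 1≤v v≤s) (≤-reflexive (sym t+v))) (certificate ∣ c (suc N) - c v ∣ s e v t)
    where
    certificate : ∀ d s e v t → d + suc e + t + (suc (s + e + (s + e)) + v + (s + e))
                              ≡ 1 + 2 * e + (s + e + (s + e)) + (suc s + d + (t + v)) + 0
    certificate = solve-∀
  ... | inj₂ s≤v = t , inj₂ (inj₁ refl) ,
    ≤-by 0 (+-mono-≤ (above s≤v v≤N) (≤-reflexive t+v)) (certificate ∣ c (suc N) - c v ∣ s e v t)
    where
    v≤N = ≤-trans (m≤n+m v t) (≤-trans (≤-reflexive t+v) (≤-trans (m≤m+n j j) (n≤1+n _)))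
    certificate : ∀ d s e v t → d + suc e + t + (suc (s + e + (s + e)) + s + (t + v))
                              ≡ 1 + 2 * t + (s + e + (s + e)) + (suc v + d + (s + e)) + 0
    certificate = solve-∀

  left≤N : ∀ {v r} → r + v ≡ j → v ≤ N
  left≤N {v} {r} eq = ≤-trans (m≤n+m v r) (≤-trans (≤-reflexive eq) (≤-trans (m≤m+n j j) (n≤1+n _)))

  sameSide : ∀ {b u r v t} → Place b u r → Place b v t → u ≢ v → SameSide u r v t
  sameSide leaf           leaf           u≢v = contradiction refl u≢v
  sameSide leaf           (left 1≤v e₂)  u≢v = sameSide-leaf 1≤v e₂
  sameSide (left 1≤u e₁)  leaf           u≢v = sameSide-sym (sameSide-leaf 1≤u e₁)
  sameSide {u = u} {v = v} (left 1≤u e₁) (left 1≤v e₂) u≢v with <-cmp u v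
  ... | tri< u<v _ _ = sameSide-left 1≤u u<v (left≤N e₂) e₁ e₂
  ... | tri≈ _ u≡v _ = contradiction u≡v u≢v
  ... | tri> _ _ v<u = sameSide-sym (sameSide-left 1≤v v<u (left≤N e₁) e₂ e₁)
  sameSide {u = u} {v = v} (right u≤N e₁) (right v≤N e₂) u≢v with <-cmp u v
  ... | tri< u<v _ _ = sameSide-right u<v v≤N e₁ e₂
  ... | tri≈ _ u≡v _ = contradiction u≡v u≢v
  ... | tri> _ _ v<u = sameSide-sym (sameSide-right v<u u≤N e₂ e₁)

  place-range : ∀ {b v r} → Place b v r → 1 ≤ v × v ≤ suc N
  place-range (left 1≤v eq)               = 1≤v , ≤-trans (left≤N eq) (n≤1+n N)
  place-range leaf                        = s≤s z≤n , ≤-refl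
  place-range (right {v} {r} v≤N refl)    = ≤-trans (s≤s z≤n) (m≤n+m (suc j) r) , ≤-trans v≤N (n≤1+n N)

  place-weight : ∀ {b v r} → Place b v r → w v ≡ r
  place-weight P = proj₂ (place-functional (proj₂ (place (proj₁ (place-range P)) (proj₂ (place-range P)))) P)

  place-x : ∀ {i} → i ≤ N → ∃ λ side → Place side (x i) (w (x i))
  place-x i≤N = place (x-positive i≤N) (x-bounded i≤N)

  edge-slack : ∀ {i b} → i < N → Place b (x i) (w (x i)) → Place b (x (suc i)) (w (x (suc i))) →
               ∃ λ m → (m ≡ w (x i) ⊎ m ≡ w (x (suc i)) ⊎ m ≡ e) × 1 + 2 * m ≤ slack i
  edge-slack {i} i<N A B with m , m∈ , le ← sameSide A B (x-injective ≤-refl i<N) =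
    m , m∈ , +-cancelʳ-≤ M (1 + 2 * m) (slack i) (≤-trans le (≤-reflexive (sym (slack-spec i<N))))

  Overlap : ℕ → ℕ → Set
  Overlap m i = m ≡ w (x i) ⊎ m ≡ w (x (suc i)) ⊎ m ≡ w (x (2 + i)) ⊎ m ≡ e

  -- Of three consecutive vertices two are on the same side.
  triple-slack : ∀ {i} → suc i < N → ∃ λ m → Overlap m i × 1 + 2 * m + 2 * w (x (suc i)) ≤ slack i + slack (suc i) + M
  triple-slack {i} i< with place-x (≤-trans (n≤1+n _) (<⇒≤ i<)) | place-x (<⇒≤ i<) | place-x i<
  ... | a , A | b , B | c′ , C = cases a b c′ A B C
    where
    wa = w (x i)
    wb = w (x (suc i))
    wc = w (x (2 + i))
    2wb≤M : 2 * wb ≤ M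
    2wb≤M = ≤-trans (*-monoʳ-≤ 2 (weight≤j B)) (≤-reflexive (cong (j +_) (+-identityʳ j)))
    first : ∀ {b} → Place b (x i) wa → Place b (x (suc i)) wb → ∃ λ m → Overlap m i × 1 + 2 * m + 2 * wb ≤ slack i + slack (suc i) + M
    first A B with edge-slack (<⇒≤ i<) A B
    ... | m , m∈ , le = m , weaken m∈ , +-mono-≤ (≤-trans le (m≤m+n _ _)) 2wb≤M
      where
      weaken : m ≡ wa ⊎ m ≡ wb ⊎ m ≡ e → Overlap m i
      weaken (inj₁ p)        = inj₁ p
      weaken (inj₂ (inj₁ p)) = inj₂ (inj₁ p)
      weaken (inj₂ (inj₂ p)) = inj₂ (inj₂ (inj₂ p))
    second : ∀ {b} → Place b (x (suc i)) wb → Place b (x (2 + i)) wc → ∃ λ m → Overlap m i × 1 + 2 * m + 2 * wb ≤ slack i + slack (suc i) + M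
    second B C with edge-slack i< B C
    ... | m , m∈ , le = m , inj₂ m∈ , +-mono-≤ (≤-trans le (m≤n+m _ (slack i))) 2wb≤M
    -- The labels of the outer vertices differ by both gaps. Adding the two slack equations then
    -- counts the weight of the inner vertex twice, whence the term `2 * wb`; in the other cases
    -- that term is absorbed by `M`.
    outer : ∀ {b} → Place b (x i) wa → Place b (x (2 + i)) wc → ∃ λ m → Overlap m i × 1 + 2 * m + 2 * wb ≤ slack i + slack (suc i) + M
    outer A C with sameSide A C (x-injective (s≤s (n≤1+n i)) i<)
    ... | m , m∈ , le = m , weaken m∈ ,
      ≤-by 0 (+-mono-≤ (subst (λ d → 1 + 2 * m + M ≤ d + wa + wc) (gap-+ i<) le)
                     (+-mono-≤ (≤-reflexive (sym (slack-spec (<⇒≤ i<)))) (≤-reflexive (sym (slack-spec i<)))))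
           (certificate m M (slack i) (slack (suc i)) (gap i) (gap (suc i)) wa wb wc)
      where
      weaken : m ≡ wa ⊎ m ≡ wc ⊎ m ≡ e → Overlap m i
      weaken (inj₁ p)        = inj₁ p
      weaken (inj₂ (inj₁ p)) = inj₂ (inj₂ (inj₁ p))
      weaken (inj₂ (inj₂ p)) = inj₂ (inj₂ (inj₂ p))
      certificate : ∀ m M f₁ f₂ g₁ g₂ wa wb wc →
        f₁ + f₂ + M + (1 + 2 * m + M + (g₁ + wa + wb + (g₂ + wb + wc)))
        ≡ 1 + 2 * m + 2 * wb + (g₁ + g₂ + wa + wc + (f₁ + M + (f₂ + M))) + 0
      certificate = solve-∀
    cases : ∀ a b c → Place a (x i) wa → Place b (x (suc i)) wb → Place c (x (2 + i)) wc →
            ∃ λ m → Overlap m i × 1 + 2 * m + 2 * wb ≤ slack i + slack (suc i) + M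
    cases false false _     A B C = first A B
    cases true  true  _     A B C = first A B
    cases false true  true  A B C = second B C
    cases true  false false A B C = second B C
    cases false true  false A B C = outer A C
    cases true  false true  A B C = outer A C

  -- This is v_{n-1}. Its weight is the largest possible, and twice that weight is exactly `M`.
  vP-place : Place true N j
  vP-place = right ≤-refl (+-suc j j)

  -- End weights are part of the total, so a vertex of weight 2 or more cannot stand at an end and
  -- has two neighbours in the order.
  inner : ∀ {b v r} → total-slack ≤ 1 → Place b v r → 2 ≤ r → ∃ λ p → suc p < N × x (suc p) ≡ v
  inner {v = v} {r} small P 2≤r with x-onto (proj₁ (place-range P)) (proj₂ (place-range P))
  ... | zero , _ , refl = contradiction (≤-trans 2≤r (≤-trans (≤-reflexive (sym (place-weight P))) (≤-trans w₀≤total small))) (<-irrefl refl)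
  ... | suc p , p<N , refl with m≤n⇒m<n∨m≡n p<N
  ...   | inj₁ p< = p , p< , refl
  ...   | inj₂ p≡ = contradiction (≤-trans 2≤r (≤-trans (≤-reflexive (trans (sym (place-weight P)) (cong (w ∘ x) p≡))) (≤-trans wₙ≤total small))) (<-irrefl refl)

  -- At weight `j` the terms `2 * wb` and `M` of `triple-slack` cancel.
  extreme-slack : ∀ {p} → suc p < N → x (suc p) ≡ N → ∃ λ m → Overlap m p × 1 + 2 * m ≤ slack p + slack (suc p)
  extreme-slack {p} p< xp with triple-slack p<
  ... | m , m∈ , le = m , m∈ , +-cancelʳ-≤ M _ _ (subst (λ y → 1 + 2 * m + y ≤ slack p + slack (suc p) + M)
    (trans (cong (2 *_) (trans (cong w xp) (place-weight vP-place))) (cong (j +_) (+-identityʳ j))) le)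

  positive-slack : 1 ≤ total-slack
  positive-slack with total-slack ≤? 1
  ... | no ≰1   = <⇒≤ (≰⇒> ≰1)
  ... | yes ≤1 with inner ≤1 vP-place 2≤j
  ...   | p , p< , xp with extreme-slack p< xp
  ...     | m , _ , le = ≤-trans (≤-trans (s≤s z≤n) le) (≤-trans (Σ<-pair slack p<) slacks≤total)

  module _ (1≤e : 1 ≤ e) where

    j⁻ : ℕ
    j⁻ = j ∸ 1

    1+j⁻≡j : suc j⁻ ≡ j
    1+j⁻≡j = m+[n∸m]≡n (<⇒≤ 2≤j)

    2≤j⁻ : 2 ≤ j⁻
    2≤j⁻ = ≤-pred (≤-trans (+-mono-≤ 2≤s 1≤e) (≤-reflexive (sym 1+j⁻≡j)))

    -- This is v_{n-2}; like v_1 it misses the maximal weight by one, so `triple-slack` still says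
    -- something about it.
    vQ-place : Place true M j⁻
    vQ-place = right (n≤1+n M) (trans (+-suc j⁻ j) (cong (_+ j) 1+j⁻≡j))

    v₁-place : Place false 1 j⁻
    v₁-place = left ≤-refl (trans (+-comm j⁻ 1) 1+j⁻≡j)

    -- The supposition to be refuted. The two gaps at v_{n-1} use up the only unit of slack, which
    -- leaves nothing for the ends or for gaps elsewhere.
    module Deficient (small : total-slack ≤ 1) where

      slacks≤1 : Σ< N slack ≤ 1
      slacks≤1 = ≤-trans slacks≤total small

      end-weights : w (x 0) ≡ 0 × w (x N) ≡ 0
      end-weights with inner small vP-place 2≤j
      ... | p , p< , xp with extreme-slack p< xp
      ...   | m , _ , le = m+n≡0⇒m≡0 (w (x 0)) sum≡0 , m+n≡0⇒n≡0 (w (x 0)) sum≡0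
        where
        1≤slacks : 1 ≤ Σ< N slack
        1≤slacks = ≤-trans (≤-trans (s≤s z≤n) le) (Σ<-pair slack p<)
        sum≡0 : w (x 0) + w (x N) ≡ 0
        sum≡0 = n≤0⇒n≡0 (+-cancelˡ-≤ 1 _ _ (≤-trans (+-monoˡ-≤ _ 1≤slacks)
          (≤-trans (≤-reflexive (sym (+-assoc (Σ< N slack) _ _))) small)))

      middle : ∀ {v} → w v ≡ 0 → v ≡ j ⊎ v ≡ suc j
      middle w≡0 with w-zero w≡0
      ... | j≤v , v≤1+j with m≤n⇒m<n∨m≡n j≤v
      ...   | inj₁ j<v  = inj₂ (≤-antisym v≤1+j j<v)
      ...   | inj₂ refl = inj₁ refl

      ends : (x 0 ≡ j × x N ≡ suc j) ⊎ (x 0 ≡ suc j × x N ≡ j)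
      ends with middle (proj₁ end-weights) | middle (proj₂ end-weights)
      ... | inj₁ p | inj₂ q = inj₁ (p , q)
      ... | inj₂ p | inj₁ q = inj₂ (p , q)
      ... | inj₁ p | inj₁ q = contradiction (trans p (sym q)) (x-injective (s≤s z≤n) ≤-refl)
      ... | inj₂ p | inj₂ q = contradiction (trans p (sym q)) (x-injective (s≤s z≤n) ≤-refl)

      weightless : ∀ {k} → k ≤ N → w (x k) ≡ 0 → k ≡ 0 ⊎ k ≡ N
      weightless {k} k≤N w≡0 = decide (middle w≡0) ends
        where
        start : x k ≡ x 0 → k ≡ 0 ⊎ k ≡ N
        start eq with k ≟ 0
        ... | yes k≡0 = inj₁ k≡0
        ... | no k≢0  = contradiction (sym eq) (x-injective (n≢0⇒n>0 k≢0) k≤N)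
        end : x k ≡ x N → k ≡ 0 ⊎ k ≡ N
        end eq with m≤n⇒m<n∨m≡n k≤N
        ... | inj₁ k<N = contradiction eq (x-injective k<N ≤-refl)
        ... | inj₂ k≡N = inj₂ k≡N
        decide : x k ≡ j ⊎ x k ≡ suc j → (x 0 ≡ j × x N ≡ suc j) ⊎ (x 0 ≡ suc j × x N ≡ j) → k ≡ 0 ⊎ k ≡ N
        decide (inj₁ p) (inj₁ (q , _)) = start (trans p (sym q))
        decide (inj₁ p) (inj₂ (_ , q)) = end (trans p (sym q))
        decide (inj₂ p) (inj₁ (_ , q)) = end (trans p (sym q))
        decide (inj₂ p) (inj₂ (q , _)) = start (trans p (sym q))

      -- `p` is the place before the vertex in question, which itself stands at `suc p`, next to an
      -- end of the order.
      Near : ℕ → Set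
      Near p = p ≡ 0 ⊎ 2 + p ≡ N

      start-near : ∀ {p} → suc p < N → p ≡ 0 ⊎ p ≡ N → Near p
      start-near p< (inj₁ p≡0) = inj₁ p≡0
      start-near p< (inj₂ p≡N) = contradiction (<⇒≤ p<) (<-irrefl p≡N)

      end-near : ∀ {p} → 2 + p ≡ 0 ⊎ 2 + p ≡ N → Near p
      end-near (inj₂ eq) = inj₂ eq

      -- Since `e` and the weight of the inner vertex are positive, overlap 0 must come from a
      -- weightless outer vertex, and these occur only at the two ends.
      no-overlap : ∀ {p} → suc p < N → 1 ≤ w (x (suc p)) → Overlap 0 p → Near p
      no-overlap p< 1≤w (inj₁ 0≡w)                = start-near p< (weightless (<⇒≤ (<⇒≤ p<)) (sym 0≡w))
      no-overlap p< 1≤w (inj₂ (inj₁ 0≡w))         = contradiction 1≤w (<-irrefl 0≡w)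
      no-overlap p< 1≤w (inj₂ (inj₂ (inj₁ 0≡w)))  = end-near (weightless p< (sym 0≡w))
      no-overlap p< 1≤w (inj₂ (inj₂ (inj₂ 0≡e)))  = contradiction 1≤e (<-irrefl 0≡e)

      near-extreme : ∀ {p} → suc p < N → x (suc p) ≡ N → Near p
      near-extreme {p} p< xp with extreme-slack p< xp
      ... | zero  , m∈ , _  = no-overlap p< (≤-trans (<⇒≤ 2≤j) (≤-reflexive (sym (trans (cong w xp) (place-weight vP-place))))) m∈
      -- A positive overlap would give slack at least 3.
      ... | suc m , _  , le = contradiction (≤-trans le (≤-trans (Σ<-pair slack p<) slacks≤1))
                                            (<⇒≱ (s≤s (s≤s z≤n)))

      -- For weight `j - 1` the inequality of `triple-slack` loses 2: a positive overlap still
      -- forces slack, and overlap 0 puts the vertex next to an end.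
      near-or-slack : ∀ {p} → suc p < N → w (x (suc p)) ≡ j⁻ → Near p ⊎ 1 ≤ slack p + slack (suc p)
      near-or-slack {p} p< wp with triple-slack p<
      ... | zero  , m∈ , _  = inj₁ (no-overlap p< (≤-trans (<⇒≤ 2≤j⁻) (≤-reflexive (sym wp))) m∈)
      ... | suc m , _  , le = inj₂ (≤-by (2 * m) (+-mono-≤ le (≤-reflexive M≡)) (certificate M m (w (x (suc p))) (slack p + slack (suc p))))
        where
        M≡ : M ≡ 2 + 2 * w (x (suc p))
        M≡ = trans (cong₂ _+_ (sym 1+j⁻≡j) (sym 1+j⁻≡j)) (trans (double j⁻) (cong (λ y → 2 + 2 * y) (sym wp)))
          where
          double : ∀ j⁻ → suc j⁻ + suc j⁻ ≡ 2 + 2 * j⁻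
          double = solve-∀
        certificate : ∀ M m W f → f + (1 + 2 * suc m + 2 * W + M) ≡ 1 + (f + M + (2 + 2 * W)) + 2 * m
        certificate = solve-∀

      separate : ∀ {p q} → 2 + p ≤ q → suc q < N → 1 ≤ slack p + slack (suc p) → 1 ≤ slack q + slack (suc q) → ⊥
      separate {p} {q} p≤q q< Fp Fq = <-irrefl refl (≤-trans
        (+-mono-≤ (≤-trans Fp (Σ<-pair {2 + p} slack ≤-refl)) Fq) (≤-trans (Σ<-append-pair slack p≤q q<) slacks≤1))

      -- Every candidate for the overlap is positive here, so this one gap has slack at least 3.
      not-adjacent : ∀ {k} → k < N → Place true (x k) (w (x k)) → Place true (x (suc k)) (w (x (suc k))) →
                     1 ≤ w (x k) → 1 ≤ w (x (suc k)) → ⊥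
      not-adjacent {k} k<N A B 1≤a 1≤b with edge-slack k<N A B
      ... | m , m∈ , le = <⇒≱ (s≤s (≤-trans (1≤m m∈) (m≤m+n m _)))
                              (≤-trans le (≤-trans (≤-trans (m≤n+m (slack k) (Σ< k slack)) (Σ<-mono slack k<N)) slacks≤1))
        where
        1≤m : m ≡ w (x k) ⊎ m ≡ w (x (suc k)) ⊎ m ≡ e → 1 ≤ m
        1≤m (inj₁ refl)        = 1≤a
        1≤m (inj₂ (inj₁ refl)) = 1≤b
        1≤m (inj₂ (inj₂ refl)) = 1≤e

      end-edge : ∀ {k b} → k < N → Place b (x k) (w (x k)) → Place b (x (suc k)) (w (x (suc k))) → 1 ≤ slack k
      end-edge k<N A B with edge-slack k<N A B
      ... | m , _ , le = ≤-trans (s≤s z≤n) le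

      middle-right : ∀ {k} → x k ≡ suc j → Place true (x k) (w (x k))
      middle-right {k} eq = subst (λ v → Place true v (w v)) (sym eq) (subst (Place true (suc j)) (sym (place-weight centre)) centre)
        where
        centre : Place true (suc j) 0
        centre = right (s≤s (m≤m+n j j)) refl

      -- The end vertex v_{j+1} has a neighbour on its own side, and this edge is disjoint from those at u.
      excluded : ∀ {q u} → 2 + q ≡ N → Place true (x 1) (w (x 1)) → Place true (x (suc q)) (w (x (suc q))) →
                 suc u < N → u ≢ 0 → u ≢ q → 1 ≤ slack u + slack (suc u) → ⊥
      excluded {q} {u} q≡ P Q u< u≢0 u≢q Fu = by-ends ends
        where
        u<q : u < q
        u<q = ≤∧≢⇒< (≤-pred (≤-pred (≤-trans u< (≤-reflexive (sym q≡))))) u≢q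
        at-start : 1 ≤ slack 0 → ⊥
        at-start F₀ = <-irrefl refl (≤-trans (+-mono-≤ F₀ Fu)
          (≤-trans (Σ<-append-pair {N} {1} slack (n≢0⇒n>0 u≢0) u<) slacks≤1))
        at-end : 1 ≤ slack (suc q) → ⊥
        at-end Fₙ = <-irrefl refl (≤-trans (+-mono-≤ (≤-trans Fu (Σ<-pair {2 + u} slack ≤-refl)) Fₙ)
          (≤-trans (Σ<-append {N} {2 + u} slack (s≤s u<q) (≤-reflexive q≡)) slacks≤1))
        by-ends : (x 0 ≡ j × x N ≡ suc j) ⊎ (x 0 ≡ suc j × x N ≡ j) → ⊥
        by-ends (inj₂ (x₀ , _)) = at-start (end-edge {0} (s≤s z≤n) (middle-right x₀) P)
        by-ends (inj₁ (_ , xₙ)) = at-end (end-edge {suc q} (≤-reflexive q≡) Q (middle-right {2 + q} (trans (cong x q≡) xₙ)))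

      weigh : ∀ {b v r k} → Place b v r → x k ≡ v → Place b (x k) (w (x k)) × w (x k) ≡ r
      weigh {b} P refl = subst (Place b _) (sym (place-weight P)) P , place-weight P

      module Configuration {p q u} (p< : suc p < N) (xp : x (suc p) ≡ N) (q< : suc q < N) (xq : x (suc q) ≡ M)
                           (u< : suc u < N) (xu : x (suc u) ≡ 1) where

        p≢q : p ≢ q
        p≢q p≡q = <-irrefl (trans (sym xq) (trans (cong (x ∘ suc) (sym p≡q)) xp)) ≤-refl

        u≢p : u ≢ p
        u≢p u≡p = <-irrefl (trans (sym xu) (trans (cong (x ∘ suc) u≡p) xp)) (s≤s (≤-trans (<⇒≤ 2≤j) (m≤m+n j j)))

        u≢q : u ≢ q
        u≢q u≡q = <-irrefl (trans (sym xu) (trans (cong (x ∘ suc) u≡q) xq)) (≤-trans 2≤j (m≤m+n j j))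

        P : Place true (x (suc p)) (w (x (suc p)))
        P = proj₁ (weigh vP-place xp)

        Q : Place true (x (suc q)) (w (x (suc q)))
        Q = proj₁ (weigh vQ-place xq)

        1≤wP : 1 ≤ w (x (suc p))
        1≤wP = ≤-trans (<⇒≤ 2≤j) (≤-reflexive (sym (proj₂ (weigh vP-place xp))))

        1≤wQ : 1 ≤ w (x (suc q))
        1≤wQ = ≤-trans (<⇒≤ 2≤j⁻) (≤-reflexive (sym (proj₂ (weigh vQ-place xq))))

        1≤Fp : 1 ≤ slack p + slack (suc p)
        1≤Fp = let m , _ , le = extreme-slack p< xp in ≤-trans (s≤s z≤n) le

        -- Slack around v_{n-2} would come on top of that around v_{n-1}, unless the two vertices
        -- share a gap; then they are neighbours on the right side, and that gap alone is too
        -- expensive.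
        near-Q : Near q
        near-Q = decide (near-or-slack q< (proj₂ (weigh vQ-place xq)))
          where
          after-P : 1 ≤ slack q + slack (suc q) → suc p < q ⊎ suc p ≡ q → ⊥
          after-P 1≤Fq (inj₁ 1+p<q) = separate 1+p<q q< 1≤Fp 1≤Fq
          after-P 1≤Fq (inj₂ refl)  = not-adjacent p< P Q 1≤wP 1≤wQ
          before-P : 1 ≤ slack q + slack (suc q) → suc q < p ⊎ suc q ≡ p → ⊥
          before-P 1≤Fq (inj₁ 1+q<p) = separate 1+q<p p< 1≤Fq 1≤Fp
          before-P 1≤Fq (inj₂ refl)  = not-adjacent q< Q P 1≤wQ 1≤wP
          decide : Near q ⊎ 1 ≤ slack q + slack (suc q) → Near q
          decide (inj₁ near) = near
          decide (inj₂ 1≤Fq) with <-cmp p q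
          ... | tri< p<q _ _ = ⊥-elim (after-P 1≤Fq (m≤n⇒m<n∨m≡n p<q))
          ... | tri≈ _ p≡q _ = ⊥-elim (p≢q p≡q)
          ... | tri> _ _ q<p = ⊥-elim (before-P 1≤Fq (m≤n⇒m<n∨m≡n q<p))

        1≤Fu : ¬ Near u → 1 ≤ slack u + slack (suc u)
        1≤Fu far = decide (near-or-slack u< (proj₂ (weigh v₁-place xu)))
          where
          decide : Near u ⊎ 1 ≤ slack u + slack (suc u) → 1 ≤ slack u + slack (suc u)
          decide (inj₁ near) = contradiction near far
          decide (inj₂ 1≤F)  = 1≤F

        far : ∀ {k l} → u ≢ k → u ≢ l → k ≡ 0 → 2 + l ≡ N → ¬ Near u
        far u≢k u≢l k≡0 l≡ (inj₁ u≡0) = u≢k (trans u≡0 (sym k≡0))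
        far u≢k u≢l k≡0 l≡ (inj₂ u≡)  = u≢l (suc-injective (suc-injective (trans u≡ (sym l≡))))

        -- v_{n-1} and v_{n-2} fill both places next to the ends. So v_1 is elsewhere and causes
        -- slack, while the end v_{j+1} causes slack with whichever of the two it meets.
        conclude : Near p → Near q → ⊥
        conclude (inj₁ p≡) (inj₁ q≡) = p≢q (trans p≡ (sym q≡))
        conclude (inj₂ p≡) (inj₂ q≡) = p≢q (suc-injective (suc-injective (trans p≡ (sym q≡))))
        conclude (inj₁ p≡) (inj₂ q≡) = excluded q≡ (subst (λ k → Place true (x (suc k)) (w (x (suc k)))) p≡ P) Q u<
          (λ u≡0 → u≢p (trans u≡0 (sym p≡))) u≢q (1≤Fu (far u≢p u≢q p≡ q≡))
        conclude (inj₂ p≡) (inj₁ q≡) = excluded p≡ (subst (λ k → Place true (x (suc k)) (w (x (suc k)))) q≡ Q) P u<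
          (λ u≡0 → u≢q (trans u≡0 (sym q≡))) u≢p (1≤Fu (far u≢q u≢p q≡ p≡))

      absurd : ⊥
      absurd = let p , p< , xp = inner small vP-place 2≤j
                   q , q< , xq = inner small vQ-place 2≤j⁻
                   u , u< , xu = inner small v₁-place 2≤j⁻
                   open Configuration p< xp q< xq u< xu
               in conclude (near-extreme p< xp) near-Q

    slack≥2 : 2 ≤ total-slack
    slack≥2 with 2 ≤? total-slack
    ... | yes le = le
    ... | no ≱2  = ⊥-elim (Deficient.absurd (≤-pred (≰⇒> ≱2)))

-- Labelings

≤-diff : ∀ {p q} r → q ≡ p + r → p ≤ q
≤-diff {p} r eq = ≤-trans (m≤m+n p r) (≤-reflexive (sym eq))

*-scale-≤ : ∀ {m n} o → m ≤ n → m * o ≤ n * o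
*-scale-≤ o = *-monoˡ-≤ o

record Apart (h φ x ψ y : ℕ) : Set where
  constructor mkApart
  field
    holds : h ≤ (∣ φ - ψ ∣ ⊔ 1) + ∣ x - y ∣

apart-sym : ∀ {h φ x ψ y} → Apart h ψ y φ x → Apart h φ x ψ y
apart-sym {h} {φ} {x} {ψ} {y} (mkApart le) = mkApart (subst₂ (λ a b → h ≤ (a ⊔ 1) + b) (∣-∣-comm ψ φ) (∣-∣-comm y x) le)

-- The `⊔ 1` supplies distance 1, so labels `h - 1` apart suffice for any positions.
apart-far : ∀ {h φ x ψ y} → h + x ≤ suc y → Apart h φ x ψ y
apart-far {h} {φ} {x} {ψ} {y} le = mkApart (+-cancelʳ-≤ x h _ (begin
  h + x                                    ≤⟨ le ⟩
  suc y                                    ≤⟨ s≤s (m≤n+∣n-m∣ y x) ⟩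
  suc (x + ∣ x - y ∣)                      ≡⟨ cong suc (+-comm x _) ⟩
  1 + ∣ x - y ∣ + x                        ≤⟨ +-monoˡ-≤ x (+-monoˡ-≤ _ (m≤n⊔m ∣ φ - ψ ∣ 1)) ⟩
  (∣ φ - ψ ∣ ⊔ 1) + ∣ x - y ∣ + x          ∎))
  where open ≤-Reasoning

-- For positions that grow with the labels; `apart-down` is for the opposite case. A difference
-- never exceeds its absolute value, so the orders themselves need no proof.
apart-up : ∀ {h φ x ψ y} → h + x + φ ≤ y + ψ → Apart h φ x ψ y
apart-up {h} {φ} {x} {ψ} {y} le = mkApart (+-cancelʳ-≤ (x + φ) h _ (begin
  h + (x + φ)                                  ≡⟨ +-assoc h x φ ⟨
  h + x + φ                                    ≤⟨ le ⟩
  y + ψ                                        ≤⟨ +-mono-≤ (m≤n+∣n-m∣ y x) (m≤n+∣n-m∣ ψ φ) ⟩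
  x + ∣ x - y ∣ + (φ + ∣ φ - ψ ∣)              ≤⟨ +-monoʳ-≤ (x + ∣ x - y ∣) (+-monoʳ-≤ φ (m≤m⊔n _ 1)) ⟩
  x + ∣ x - y ∣ + (φ + (∣ φ - ψ ∣ ⊔ 1))        ≡⟨ regroup x ∣ x - y ∣ φ (∣ φ - ψ ∣ ⊔ 1) ⟩
  (∣ φ - ψ ∣ ⊔ 1) + ∣ x - y ∣ + (x + φ)        ∎))
  where
  open ≤-Reasoning
  regroup : ∀ x d φ e → x + d + (φ + e) ≡ e + d + (x + φ)
  regroup = solve-∀

apart-down : ∀ {h φ x ψ y} → h + x + ψ ≤ y + φ → Apart h φ x ψ y
apart-down {h} {φ} {x} {ψ} {y} le =
  mkApart (subst (λ d → h ≤ (d ⊔ 1) + ∣ x - y ∣) (∣-∣-comm ψ φ) (Apart.holds (apart-up {h} {ψ} {x} {φ} {y} le)))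

-- V v φ x relates the index v of a vertex to its folded position φ and its label x.
record Layout (N s T : ℕ) : Set₁ where
  field
    V       : ℕ → ℕ → ℕ → Set
    locate  : ∀ {v} → 1 ≤ v → v ≤ suc N → ∃₂ (V v)
    on-fold : ∀ {v φ x} → V v φ x → (v ≤ N × φ ≡ v) ⊎ (v ≡ suc N × φ ≡ s ∸ 1)
    bounds  : ∀ {v φ x} → V v φ x → 1 ≤ x × x ≤ T
    apart   : ∀ {u v φ x ψ y} → V u φ x → V v ψ y → u ≢ v → Apart N φ x ψ y

  labeling : ℕ → ℕ
  labeling v with 1 ≤? v | v ≤? suc N
  ... | yes 1≤v | yes v≤ = proj₁ (proj₂ (locate 1≤v v≤))
  ... | _       | _      = 0

  labeled : ∀ {v} → 1 ≤ v → v ≤ suc N → ∃ λ φ → V v φ (labeling v)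
  labeled {v} 1≤v v≤ with 1 ≤? v | v ≤? suc N
  ... | yes p | yes q = _ , proj₂ (proj₂ (locate p q))
  ... | yes _ | no ≰  = contradiction v≤ ≰
  ... | no ≰  | _     = contradiction 1≤v ≰

  folded≡ : ∀ {v φ x} → V v φ x → folded N s v ≡ φ
  folded≡ A with on-fold A
  ... | inj₁ (v≤N , refl)  = folded-path v≤N
  ... | inj₂ (refl , refl) = folded-leaf {N} {s}

  spread : Spread N s labeling
  spread = record
    { positive = λ 1≤i i≤ → proj₁ (bounds (proj₂ (labeled 1≤i i≤)))
    ; spread   = λ {i} {j} 1≤i i≤ 1≤j j≤ i≢j → separated (proj₂ (labeled 1≤i i≤)) (proj₂ (labeled 1≤j j≤)) i≢j
    }
    where
    separated : ∀ {i j φ ψ} → V i φ (labeling i) → V j ψ (labeling j) → i ≢ j →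
                N ≤ (∣ folded N s i - folded N s j ∣ ⊔ 1) + ∣ labeling i - labeling j ∣
    separated {i} {j} A B i≢j = subst₂ (λ a b → N ≤ (∣ a - b ∣ ⊔ 1) + ∣ labeling i - labeling j ∣)
      (sym (folded≡ A)) (sym (folded≡ B)) (Apart.holds (apart A B i≢j))

-- For n = 2 k + 1, with k = q + 1: v_k, v_{2k}, the leaf, then v_{k+i}, v_i for i = 1, …, q.
module Odd (q s′ : ℕ) where

  N T : ℕ
  N = suc q + suc q
  T = 2 * q * suc q + 2 * (2 + s′)

  data V : ℕ → ℕ → ℕ → Set where
    centre : V (suc q) (suc q) 1
    last   : V (suc q + suc q) (suc q + suc q) (2 + q)
    leaf   : V (suc (suc q + suc q)) (suc s′) (3 + q + s′)
    -- A round costs `2 * q + 1`: a gap `q + 1` within a pair at distance k and `q` to the next pair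
    -- at distance k + 1. All consecutive gaps are tight; the only loss is the weight 1 of the final
    -- vertex v_{k-1}.
    right  : ∀ i → i < q → V (suc q + suc i) (suc q + suc i) (2 * q + 2 * s′ + 4 + i * (2 * q + 1))
    left   : ∀ i → i < q → V (suc i) (suc i) (2 * q + 2 * s′ + 4 + i * (2 * q + 1) + suc q)

  apart-centre : ∀ {v ψ y} → V v ψ y → suc q ≢ v → Apart (suc q + suc q) (suc q) 1 ψ y
  apart-centre centre      ≢ = contradiction refl ≢
  apart-centre last        _ = apart-up (≤-diff 0 (solve (q ∷ [])))
  apart-centre leaf        _ = apart-down (≤-diff 0 (solve (q ∷ s′ ∷ [])))
  apart-centre (right i _) _ = apart-far (≤-diff (2 + i + 2 * s′ + 2 * i * q) (solve (q ∷ s′ ∷ i ∷ [])))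
  apart-centre (left i _)  _ = apart-far (≤-diff (3 + i + q + 2 * s′ + 2 * i * q) (solve (q ∷ s′ ∷ i ∷ [])))

  apart-last : ∀ {v ψ y} → V v ψ y → suc q + suc q ≢ v → Apart (suc q + suc q) (suc q + suc q) (2 + q) ψ y
  apart-last centre      ≢ = apart-sym (apart-centre last (≢-sym ≢))
  apart-last last        ≢ = contradiction refl ≢
  apart-last leaf        _ = apart-down (≤-diff 0 (solve (q ∷ s′ ∷ [])))
  apart-last (right i _) _ = apart-down (≤-diff (2 * s′ + 2 * i * q) (solve (q ∷ i ∷ s′ ∷ [])))
  apart-last (left i _)  _ = apart-far (≤-diff (2 + i + 2 * s′ + 2 * i * q) (solve (q ∷ s′ ∷ i ∷ [])))

  apart-leaf : ∀ {v ψ y} → V v ψ y → suc (suc q + suc q) ≢ v → Apart (suc q + suc q) (suc s′) (3 + q + s′) ψ y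
  apart-leaf centre      ≢ = apart-sym (apart-centre leaf (≢-sym ≢))
  apart-leaf last        ≢ = apart-sym (apart-last leaf (≢-sym ≢))
  apart-leaf leaf        ≢ = contradiction refl ≢
  apart-leaf (right i _) _ = apart-up (≤-diff (2 * i + 2 * i * q) (solve (q ∷ s′ ∷ i ∷ [])))
  apart-leaf (left i _)  _ = apart-far (≤-diff (1 + i + s′ + 2 * i * q) (solve (q ∷ s′ ∷ i ∷ [])))

  apart-right-left : ∀ i i′ → Apart (suc q + suc q) (suc q + suc i) (2 * q + 2 * s′ + 4 + i * (2 * q + 1))
                                    (suc i′) (2 * q + 2 * s′ + 4 + i′ * (2 * q + 1) + suc q)
  apart-right-left i i′ with compare i i′
  ... | less i t    = apart-down (≤-diff (2 * q + 2 * q * t) (solve (q ∷ s′ ∷ i ∷ t ∷ [])))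
  ... | equal i     = apart-down (≤-diff 0 (solve (q ∷ s′ ∷ i ∷ [])))
  ... | greater i t = apart-sym (apart-up (≤-diff (2 * t + 2 * q * t) (solve (q ∷ s′ ∷ i ∷ t ∷ []))))

  apart : ∀ {u v φ x ψ y} → V u φ x → V v ψ y → u ≢ v → Apart N φ x ψ y
  apart centre B ≢ = apart-centre B ≢
  apart last   B ≢ = apart-last B ≢
  apart leaf   B ≢ = apart-leaf B ≢
  apart A centre ≢ = apart-sym (apart-centre A (≢-sym ≢))
  apart A last   ≢ = apart-sym (apart-last A (≢-sym ≢))
  apart A leaf   ≢ = apart-sym (apart-leaf A (≢-sym ≢))
  apart (right i _) (left i′ _) _ = apart-right-left i i′
  apart (left i _) (right i′ _) _ = apart-sym (apart-right-left i′ i)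
  apart (right i _) (right i′ _) ≢ with compare i i′
  ... | less i t    = apart-up (≤-diff (2 * t + 2 * q * t) (solve (q ∷ s′ ∷ i ∷ t ∷ [])))
  ... | equal i     = contradiction refl ≢
  ... | greater i t = apart-sym (apart-up (≤-diff (2 * t + 2 * q * t) (solve (q ∷ s′ ∷ i ∷ t ∷ []))))
  apart (left i _) (left i′ _) ≢ with compare i i′
  ... | less i t    = apart-up (≤-diff (2 * t + 2 * q * t) (solve (q ∷ s′ ∷ i ∷ t ∷ [])))
  ... | equal i     = contradiction refl ≢
  ... | greater i t = apart-sym (apart-up (≤-diff (2 * t + 2 * q * t) (solve (q ∷ s′ ∷ i ∷ t ∷ []))))

  bounds : ∀ {v φ x} → V v φ x → 1 ≤ x × x ≤ 2 * q * suc q + 2 * (2 + s′)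
  bounds centre        = s≤s z≤n , ≤-diff (3 + 2 * q + 2 * s′ + 2 * q * q) (solve (q ∷ s′ ∷ []))
  bounds last          = s≤s z≤n , ≤-diff (2 + q + 2 * s′ + 2 * q * q) (solve (q ∷ s′ ∷ []))
  bounds leaf          = s≤s z≤n , ≤-diff (1 + q + s′ + 2 * q * q) (solve (q ∷ s′ ∷ []))
  bounds (right i i<q) = ≤-diff (3 + i + 2 * q + 2 * s′ + 2 * i * q) (solve (q ∷ s′ ∷ i ∷ [])) ,
    ≤-by (1 + q) (*-scale-≤ (2 * q + 1) i<q) (solve (q ∷ s′ ∷ i ∷ []))
  bounds (left i i<q)  = ≤-diff (4 + i + 3 * q + 2 * s′ + 2 * i * q) (solve (q ∷ s′ ∷ i ∷ [])) ,
    ≤-by 0 (*-scale-≤ (2 * q + 1) i<q) (solve (q ∷ s′ ∷ i ∷ []))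

  on-fold : ∀ {v φ x} → V v φ x → (v ≤ N × φ ≡ v) ⊎ (v ≡ suc N × φ ≡ (2 + s′) ∸ 1)
  on-fold centre        = inj₁ (m≤m+n (suc q) (suc q) , refl)
  on-fold last          = inj₁ (≤-refl , refl)
  on-fold leaf          = inj₂ (refl , refl)
  on-fold (right i i<q) = inj₁ (+-monoʳ-≤ (suc q) (<⇒≤ (s≤s i<q)) , refl)
  on-fold (left i i<q)  = inj₁ (≤-trans i<q (≤-trans (n≤1+n q) (m≤m+n (suc q) (suc q))) , refl)

  on-path : ∀ {u v x} → u ≡ v → V u u x → V v v x
  on-path refl A = A

  locate : ∀ {v} → 1 ≤ v → v ≤ suc N → ∃₂ (V v)
  locate {suc v} _ v≤ with m≤n⇒m<n∨m≡n v≤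
  ... | inj₂ refl = _ , _ , leaf
  ... | inj₁ v<   with <-cmp v q
  ...   | tri< v<q _ _  = _ , _ , left v v<q
  ...   | tri≈ _ refl _ = _ , _ , centre
  ...   | tri> _ _ q<v  with i , refl ← m≤n⇒∃[o]m+o≡n q<v
                        with m≤n⇒m<n∨m≡n (+-cancelˡ-≤ q i q (≤-pred (≤-pred (≤-trans (≤-pred v<) (≤-reflexive (+-suc (suc q) q))))))
  ...     | inj₁ i<q  = _ , _ , on-path (cong suc (+-suc q i)) (right i i<q)
  ...     | inj₂ refl = _ , _ , on-path (cong suc (+-suc q q)) last

  layout : Layout N (2 + s′) T
  layout = record { V = V ; locate = locate ; on-fold = on-fold ; bounds = bounds ; apart = apart }

-- For n = 2 j + 2 and s < j, with j = j′ + 3: v_j, v_{2j+1}, the leaf, then v_{j+2+i}, v_{2+i} for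
-- i = 0, …, j - 3, and finally v_{2j}, v_1, v_{j+1}.
module Even (j′ s′ : ℕ) where

  N T : ℕ
  N = suc (3 + j′ + (3 + j′))
  T = 2 * (3 + j′) * (3 + j′) + 2 * (2 + s′) + 1

  data V : ℕ → ℕ → ℕ → Set where
    start  : V (3 + j′) (3 + j′) 1
    last   : V (suc (3 + j′ + (3 + j′))) (suc (3 + j′ + (3 + j′))) (4 + j′)
    -- One more than v_{2j+1} demands: v_j, two places earlier, lies on the side of the leaf. This
    -- is the first unit of slack.
    leaf   : V (suc (suc (3 + j′ + (3 + j′)))) (suc s′) (6 + j′ + s′)
    -- The last value `i = suc j′` is v_{2j}, which is followed by v_1 and not by a vertex `left`.
    right  : ∀ i t → i + t ≡ suc j′ → V (5 + j′ + i) (5 + j′ + i) (9 + 2 * j′ + 2 * s′ + i * (7 + 2 * j′))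
    left   : ∀ i t → i + t ≡ j′ → V (2 + i) (2 + i) (9 + 2 * j′ + 2 * s′ + i * (7 + 2 * j′) + (4 + j′))
    -- The gap is 3 where v_{2j} demands only 2, because of v_{j-1} two places earlier on the same
    -- side. This is the second unit of slack.
    first  : V 1 1 (9 + 2 * j′ + 2 * s′ + suc j′ * (7 + 2 * j′) + 3)
    finish : V (4 + j′) (4 + j′) (9 + 2 * j′ + 2 * s′ + suc j′ * (7 + 2 * j′) + (7 + j′))

  apart-start : ∀ {v ψ y} → V v ψ y → 3 + j′ ≢ v → Apart (suc (3 + j′ + (3 + j′))) (3 + j′) 1 ψ y
  apart-start start         ≢ = contradiction refl ≢
  apart-start last          _ = apart-up (≤-diff 0 (solve (j′ ∷ [])))
  apart-start leaf          _ = apart-down (≤-diff 0 (solve (j′ ∷ s′ ∷ [])))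
  apart-start (right i _ _) _ = apart-far (≤-diff (2 + 7 * i + 2 * s′ + 2 * i * j′) (solve (j′ ∷ s′ ∷ i ∷ [])))
  apart-start (left i _ _)  _ = apart-far (≤-diff (6 + 7 * i + j′ + 2 * s′ + 2 * i * j′) (solve (j′ ∷ s′ ∷ i ∷ [])))
  apart-start first         _ = apart-far (≤-diff (12 + 9 * j′ + 2 * s′ + 2 * j′ * j′) (solve (j′ ∷ s′ ∷ [])))
  apart-start finish        _ = apart-far (≤-diff (16 + 10 * j′ + 2 * s′ + 2 * j′ * j′) (solve (j′ ∷ s′ ∷ [])))

  apart-last : ∀ {v ψ y} → V v ψ y → suc (3 + j′ + (3 + j′)) ≢ v → Apart (suc (3 + j′ + (3 + j′))) (suc (3 + j′ + (3 + j′))) (4 + j′) ψ y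
  apart-last start         ≢ = apart-sym (apart-start last (≢-sym ≢))
  apart-last last          ≢ = contradiction refl ≢
  apart-last leaf          _ = apart-down (≤-diff 1 (solve (j′ ∷ s′ ∷ [])))
  apart-last (right i _ _) _ = apart-down (≤-diff (6 * i + 2 * s′ + 2 * i * j′) (solve (j′ ∷ i ∷ s′ ∷ [])))
  apart-last (left i _ _)  _ = apart-far (≤-diff (3 + 7 * i + 2 * s′ + 2 * i * j′) (solve (j′ ∷ s′ ∷ i ∷ [])))
  apart-last first         _ = apart-far (≤-diff (9 + 8 * j′ + 2 * s′ + 2 * j′ * j′) (solve (j′ ∷ s′ ∷ [])))
  apart-last finish        _ = apart-far (≤-diff (13 + 9 * j′ + 2 * s′ + 2 * j′ * j′) (solve (j′ ∷ s′ ∷ [])))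

  apart-leaf : ∀ {v ψ y} → V v ψ y → suc (suc (3 + j′ + (3 + j′))) ≢ v → Apart (suc (3 + j′ + (3 + j′))) (suc s′) (6 + j′ + s′) ψ y
  apart-leaf start         ≢ = apart-sym (apart-start leaf (≢-sym ≢))
  apart-leaf last          ≢ = apart-sym (apart-last leaf (≢-sym ≢))
  apart-leaf leaf          ≢ = contradiction refl ≢
  apart-leaf (right i _ _) _ = apart-up (≤-diff (8 * i + 2 * i * j′) (solve (j′ ∷ s′ ∷ i ∷ [])))
  apart-leaf (left i _ _)  _ = apart-far (≤-diff (1 + 7 * i + s′ + 2 * i * j′) (solve (j′ ∷ s′ ∷ i ∷ [])))
  apart-leaf first         _ = apart-far (≤-diff (7 + 8 * j′ + s′ + 2 * j′ * j′) (solve (j′ ∷ s′ ∷ [])))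
  apart-leaf finish        _ = apart-far (≤-diff (11 + 9 * j′ + s′ + 2 * j′ * j′) (solve (j′ ∷ s′ ∷ [])))

  apart-first : ∀ {v ψ y} → V v ψ y → 1 ≢ v → Apart (suc (3 + j′ + (3 + j′))) 1 (9 + 2 * j′ + 2 * s′ + suc j′ * (7 + 2 * j′) + 3) ψ y
  apart-first start          ≢ = apart-sym (apart-start first (≢-sym ≢))
  apart-first last           ≢ = apart-sym (apart-last first (≢-sym ≢))
  apart-first leaf           ≢ = apart-sym (apart-leaf first (≢-sym ≢))
  apart-first (right i t eq) _ = apart-sym (apart-down (≤-by (1 + 6 * t + 2 * j′ * t) (+-mono-≤ (*-scale-≤ (7 + 2 * j′) (≤-reflexive eq)) (≤-reflexive (sym eq))) (solve (j′ ∷ s′ ∷ i ∷ t ∷ []))))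
  apart-first (left i t eq)  _ = apart-sym (apart-down (≤-by (6 * t + 2 * j′ * t) (+-mono-≤ (*-scale-≤ (7 + 2 * j′) (≤-reflexive eq)) (≤-reflexive (sym eq))) (solve (j′ ∷ s′ ∷ i ∷ t ∷ []))))
  apart-first first          ≢ = contradiction refl ≢
  apart-first finish         _ = apart-up (≤-diff 0 (solve (j′ ∷ s′ ∷ [])))

  apart-finish : ∀ {v ψ y} → V v ψ y → 4 + j′ ≢ v → Apart (suc (3 + j′ + (3 + j′))) (4 + j′) (9 + 2 * j′ + 2 * s′ + suc j′ * (7 + 2 * j′) + (7 + j′)) ψ y
  apart-finish start          ≢ = apart-sym (apart-start finish (≢-sym ≢))
  apart-finish last           ≢ = apart-sym (apart-last finish (≢-sym ≢))
  apart-finish leaf           ≢ = apart-sym (apart-leaf finish (≢-sym ≢))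
  apart-finish (right i t eq) _ = apart-sym (apart-down (≤-by (2 + 6 * t + 2 * j′ * t) (+-mono-≤ (*-scale-≤ (7 + 2 * j′) (≤-reflexive eq)) (≤-reflexive (sym eq))) (solve (j′ ∷ s′ ∷ i ∷ t ∷ []))))
  apart-finish (left i t eq)  _ = apart-sym (apart-far (≤-by (4 + 7 * t + 2 * j′ * t) (*-scale-≤ (7 + 2 * j′) (≤-reflexive eq)) (solve (j′ ∷ s′ ∷ i ∷ t ∷ []))))
  apart-finish first          ≢ = apart-sym (apart-first finish (≢-sym ≢))
  apart-finish finish         ≢ = contradiction refl ≢

  apart-right-left : ∀ i i′ → Apart (suc (3 + j′ + (3 + j′))) (5 + j′ + i) (9 + 2 * j′ + 2 * s′ + i * (7 + 2 * j′)) (2 + i′) (9 + 2 * j′ + 2 * s′ + i′ * (7 + 2 * j′) + (4 + j′))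
  apart-right-left i i′ with compare i i′
  ... | less i t    = apart-down (≤-diff (6 + 2 * j′ + 6 * t + 2 * j′ * t) (solve (j′ ∷ s′ ∷ i ∷ t ∷ [])))
  ... | equal i     = apart-down (≤-diff 0 (solve (j′ ∷ s′ ∷ i ∷ [])))
  ... | greater i t = apart-sym (apart-up (≤-diff (8 * t + 2 * j′ * t) (solve (j′ ∷ s′ ∷ i ∷ t ∷ []))))

  apart : ∀ {u v φ x ψ y} → V u φ x → V v ψ y → u ≢ v → Apart N φ x ψ y
  apart start  B ≢ = apart-start B ≢
  apart last   B ≢ = apart-last B ≢
  apart leaf   B ≢ = apart-leaf B ≢
  apart first  B ≢ = apart-first B ≢
  apart finish B ≢ = apart-finish B ≢
  apart A start  ≢ = apart-sym (apart-start A (≢-sym ≢))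
  apart A last   ≢ = apart-sym (apart-last A (≢-sym ≢))
  apart A leaf   ≢ = apart-sym (apart-leaf A (≢-sym ≢))
  apart A first  ≢ = apart-sym (apart-first A (≢-sym ≢))
  apart A finish ≢ = apart-sym (apart-finish A (≢-sym ≢))
  apart (right i _ _) (left i′ _ _) _ = apart-right-left i i′
  apart (left i _ _) (right i′ _ _) _ = apart-sym (apart-right-left i′ i)
  apart (right i _ _) (right i′ _ _) ≢ with compare i i′
  ... | less i t    = apart-far (≤-diff (1 + 7 * t + 2 * j′ * t) (solve (j′ ∷ s′ ∷ i ∷ t ∷ [])))
  ... | equal i     = contradiction refl ≢
  ... | greater i t = apart-sym (apart-far (≤-diff (1 + 7 * t + 2 * j′ * t) (solve (j′ ∷ s′ ∷ i ∷ t ∷ []))))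
  apart (left i _ _) (left i′ _ _) ≢ with compare i i′
  ... | less i t    = apart-far (≤-diff (1 + 7 * t + 2 * j′ * t) (solve (j′ ∷ s′ ∷ i ∷ t ∷ [])))
  ... | equal i     = contradiction refl ≢
  ... | greater i t = apart-sym (apart-far (≤-diff (1 + 7 * t + 2 * j′ * t) (solve (j′ ∷ s′ ∷ i ∷ t ∷ []))))

  bounds : ∀ {v φ x} → V v φ x → 1 ≤ x × x ≤ 2 * (3 + j′) * (3 + j′) + 2 * (2 + s′) + 1
  bounds start          = s≤s z≤n , ≤-diff (22 + 12 * j′ + 2 * s′ + 2 * j′ * j′) (solve (j′ ∷ s′ ∷ []))
  bounds last           = s≤s z≤n , ≤-diff (19 + 11 * j′ + 2 * s′ + 2 * j′ * j′) (solve (j′ ∷ s′ ∷ []))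
  bounds leaf           = s≤s z≤n , ≤-diff (17 + 11 * j′ + s′ + 2 * j′ * j′) (solve (j′ ∷ s′ ∷ []))
  bounds (right i t eq) = s≤s z≤n , ≤-by (7 + j′ + 7 * t + 2 * j′ * t) (*-scale-≤ (7 + 2 * j′) (≤-reflexive eq)) (solve (j′ ∷ s′ ∷ i ∷ t ∷ []))
  bounds (left i t eq)  = s≤s z≤n , ≤-by (10 + 2 * j′ + 7 * t + 2 * j′ * t) (*-scale-≤ (7 + 2 * j′) (≤-reflexive eq)) (solve (j′ ∷ s′ ∷ i ∷ t ∷ []))
  bounds first          = s≤s z≤n , ≤-diff (4 + j′) (solve (j′ ∷ s′ ∷ []))
  bounds finish         = s≤s z≤n , ≤-diff 0 (solve (j′ ∷ s′ ∷ []))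

  on-fold : ∀ {v φ x} → V v φ x → (v ≤ suc (3 + j′ + (3 + j′)) × φ ≡ v) ⊎ (v ≡ suc N × φ ≡ (2 + s′) ∸ 1)
  on-fold start          = inj₁ (≤-diff (4 + j′) (solve (j′ ∷ [])) , refl)
  on-fold last           = inj₁ (≤-refl , refl)
  on-fold leaf           = inj₂ (refl , refl)
  on-fold (right i t eq) = inj₁ (≤-by (1 + t) (≤-reflexive eq) (solve (j′ ∷ i ∷ t ∷ [])) , refl)
  on-fold (left i t eq)  = inj₁ (≤-by (5 + j′ + t) (≤-reflexive eq) (solve (i ∷ j′ ∷ t ∷ [])) , refl)
  on-fold first          = inj₁ (s≤s z≤n , refl)
  on-fold finish         = inj₁ (≤-diff (3 + j′) (solve (j′ ∷ [])) , refl)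

  on-path : ∀ {u v x} → u ≡ v → V u u x → V v v x
  on-path refl A = A

  locate-right : ∀ {i} → 5 + j′ + i ≤ N → ∃₂ (V (5 + j′ + i))
  locate-right {i} v≤N with m≤n⇒m<n∨m≡n v≤N
  ... | inj₂ v≡N = _ , _ , on-path (sym v≡N) last
  ... | inj₁ v<N with t , eq ← m≤n⇒∃[o]m+o≡n (≤-pred (+-cancelˡ-≤ (5 + j′) (suc i) (2 + j′) (≤-trans (≤-reflexive (+-suc (5 + j′) i)) (≤-trans v<N (≤-reflexive (cong (4 +_) (+-suc j′ (2 + j′))))))))
    = _ , _ , right i t eq

  locate : ∀ {v} → 1 ≤ v → v ≤ suc N → ∃₂ (V v)
  locate {1} _ _ = _ , _ , first
  locate {suc (suc v)} _ v≤ with m≤n⇒m<n∨m≡n v≤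
  ... | inj₂ refl = _ , _ , leaf
  ... | inj₁ v<   with <-cmp v (suc j′)
  ...   | tri≈ _ refl _ = _ , _ , start
  ...   | tri< v<1+j′ _ _ with t , eq ← m≤n⇒∃[o]m+o≡n (≤-pred v<1+j′) = _ , _ , left v t eq
  ...   | tri> _ _ 1+j′<v with m≤n⇒∃[o]m+o≡n 1+j′<v
  ...     | zero  , refl = _ , _ , on-path (cong (4 +_) (sym (+-identityʳ j′))) finish
  ...     | suc i , refl = subst (λ v → ∃₂ (V v)) (cong (4 +_) (sym (+-suc j′ i)))
                             (locate-right (≤-trans (≤-reflexive (cong (4 +_) (sym (+-suc j′ i)))) (≤-pred v<)))

  layout : Layout N (2 + s′) T
  layout = record { V = V ; locate = locate ; on-fold = on-fold ; bounds = bounds ; apart = apart }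

-- For n = 2 j + 2 and j ≤ s ≤ j + 1, with j = j′ + 1 and s = σ′ + 1: v_j, v_{2j+1}, the leaf, then
-- v_{2j-i}, v_{j-1-i} for i = 0, …, j - 2, and finally v_{j+1}.
module Central (j′ σ′ : ℕ) (lo : j′ ≤ σ′) (hi : σ′ ≤ suc j′) where

  N T : ℕ
  N = suc (suc j′ + suc j′)
  T = 4 + 2 * j′ + σ′ + j′ * (3 + 2 * j′)

  data V : ℕ → ℕ → ℕ → Set where
    start  : V (suc j′) (suc j′) 1
    last   : V (suc (suc j′ + suc j′)) (suc (suc j′ + suc j′)) (2 + j′)
    -- The leaf is folded onto v_j or v_{j-1}, so its distance from `start` counts as 1, which
    -- forces the label `N`.
    leaf   : V (suc (suc (suc j′ + suc j′))) σ′ (suc (suc j′ + suc j′))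
    -- `m` counts down, so both sides are traversed towards smaller indices: a gap j within a pair
    -- at distance j + 1, and j + 1 to the next pair, or from v_1 to the final v_{j+1}, at distance
    -- j.
    right  : ∀ i m → i + suc m ≡ j′ → V (3 + j′ + m) (3 + j′ + m) (4 + 2 * j′ + σ′ + i * (3 + 2 * j′))
    left   : ∀ i m → i + suc m ≡ j′ → V (suc m) (suc m) (4 + 2 * j′ + σ′ + i * (3 + 2 * j′) + suc j′)
    finish : V (2 + j′) (2 + j′) (4 + 2 * j′ + σ′ + j′ * (3 + 2 * j′))

  apart-start : ∀ {v ψ y} → V v ψ y → suc j′ ≢ v → Apart (suc (suc j′ + suc j′)) (suc j′) 1 ψ y
  apart-start start         ≢ = contradiction refl ≢
  apart-start last          _ = apart-up (≤-diff 0 (solve (j′ ∷ [])))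
  apart-start leaf          _ = apart-far (≤-diff 0 (solve (j′ ∷ [])))
  apart-start (right i m _) _ = apart-far (≤-diff (1 + 3 * i + σ′ + 2 * i * j′) (solve (j′ ∷ σ′ ∷ i ∷ [])))
  apart-start (left i m _)  _ = apart-far (≤-diff (2 + 3 * i + j′ + σ′ + 2 * i * j′) (solve (j′ ∷ σ′ ∷ i ∷ [])))
  apart-start finish        _ = apart-far (≤-diff (1 + 3 * j′ + σ′ + 2 * j′ * j′) (solve (j′ ∷ σ′ ∷ [])))

  apart-last : ∀ {v ψ y} → V v ψ y → suc (suc j′ + suc j′) ≢ v → Apart (suc (suc j′ + suc j′)) (suc (suc j′ + suc j′)) (2 + j′) ψ y
  apart-last start          ≢ = apart-sym (apart-start last (≢-sym ≢))
  apart-last last           ≢ = contradiction refl ≢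
  apart-last leaf           _ = apart-down (≤-by 0 hi (solve (j′ ∷ σ′ ∷ [])))
  apart-last (right i m eq) _ = apart-down (≤-by (4 * i + 2 * i * j′) (+-mono-≤ lo (≤-reflexive eq)) (solve (j′ ∷ m ∷ σ′ ∷ i ∷ [])))
  apart-last (left i m _)   _ = apart-far (≤-by (1 + 3 * i + j′ + 2 * i * j′) lo (solve (j′ ∷ σ′ ∷ i ∷ [])))
  apart-last finish         _ = apart-far (≤-by (3 * j′ + 2 * j′ * j′) lo (solve (j′ ∷ σ′ ∷ [])))

  apart-leaf : ∀ {v ψ y} → V v ψ y → suc (suc (suc j′ + suc j′)) ≢ v → Apart (suc (suc j′ + suc j′)) σ′ (suc (suc j′ + suc j′)) ψ y
  apart-leaf start          ≢ = apart-sym (apart-start leaf (≢-sym ≢))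
  apart-leaf last           ≢ = apart-sym (apart-last leaf (≢-sym ≢))
  apart-leaf leaf           ≢ = contradiction refl ≢
  apart-leaf (right i m eq) _ = apart-up (≤-by (2 * i + 2 * i * j′) (≤-reflexive (sym eq)) (solve (j′ ∷ σ′ ∷ i ∷ m ∷ [])))
  apart-leaf (left i m eq)  _ = apart-far (≤-by (3 * i + 2 * i * j′) lo (solve (j′ ∷ σ′ ∷ i ∷ [])))
  apart-leaf finish         _ = apart-up (≤-diff (2 * j′ + 2 * j′ * j′) (solve (j′ ∷ σ′ ∷ [])))

  apart-finish : ∀ {v ψ y} → V v ψ y → 2 + j′ ≢ v → Apart (suc (suc j′ + suc j′)) (2 + j′) (4 + 2 * j′ + σ′ + j′ * (3 + 2 * j′)) ψ y
  apart-finish start          ≢ = apart-sym (apart-start finish (≢-sym ≢))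
  apart-finish last           ≢ = apart-sym (apart-last finish (≢-sym ≢))
  apart-finish leaf           ≢ = apart-sym (apart-leaf finish (≢-sym ≢))
  apart-finish (right i m eq) _ = apart-sym (apart-far (≤-by (1 + 3 * m + 2 * j′ * m) (*-scale-≤ (3 + 2 * j′) (≤-reflexive eq)) (solve (j′ ∷ σ′ ∷ i ∷ m ∷ []))))
  apart-finish (left i m eq)  _ = apart-sym (apart-up (≤-by (2 * m + 2 * j′ * m) (*-scale-≤ (3 + 2 * j′) (≤-reflexive eq)) (solve (j′ ∷ σ′ ∷ i ∷ m ∷ []))))
  apart-finish finish         ≢ = contradiction refl ≢

  apart-right-left : ∀ i m i′ m′ → i + suc m ≡ j′ → i′ + suc m′ ≡ j′ →
    Apart (suc (suc j′ + suc j′)) (3 + j′ + m) (4 + 2 * j′ + σ′ + i * (3 + 2 * j′)) (suc m′) (4 + 2 * j′ + σ′ + i′ * (3 + 2 * j′) + suc j′)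
  apart-right-left i m i′ m′ eq eq′ with compare i i′
  ... | less i t    = apart-down (≤-by (4 + 2 * j′ + 4 * t + 2 * j′ * t) (≤-reflexive (trans eq′ (sym eq))) (solve (j′ ∷ σ′ ∷ i ∷ m′ ∷ t ∷ m ∷ [])))
  ... | equal i     = apart-down (≤-by 0 (≤-reflexive (trans eq′ (sym eq))) (solve (j′ ∷ σ′ ∷ i ∷ m′ ∷ m ∷ [])))
  ... | greater i t = apart-sym (apart-up (≤-by (2 * t + 2 * j′ * t) (≤-reflexive (trans eq′ (sym eq))) (solve (j′ ∷ σ′ ∷ i ∷ m′ ∷ t ∷ m ∷ []))))

  apart : ∀ {u v φ x ψ y} → V u φ x → V v ψ y → u ≢ v → Apart N φ x ψ y
  apart start  B ≢ = apart-start B ≢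
  apart last   B ≢ = apart-last B ≢
  apart leaf   B ≢ = apart-leaf B ≢
  apart finish B ≢ = apart-finish B ≢
  apart A start  ≢ = apart-sym (apart-start A (≢-sym ≢))
  apart A last   ≢ = apart-sym (apart-last A (≢-sym ≢))
  apart A leaf   ≢ = apart-sym (apart-leaf A (≢-sym ≢))
  apart A finish ≢ = apart-sym (apart-finish A (≢-sym ≢))
  apart (right i m eq) (left i′ m′ eq′) _ = apart-right-left i m i′ m′ eq eq′
  apart (left i m eq) (right i′ m′ eq′) _ = apart-sym (apart-right-left i′ m′ i m eq′ eq)
  apart (right i m eq) (right i′ m′ eq′) ≢ with compare i i′
  ... | less i t    = apart-far (≤-diff (1 + 3 * t + 2 * j′ * t) (solve (j′ ∷ σ′ ∷ i ∷ t ∷ [])))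
  ... | equal i     = contradiction (cong (2 + j′ +_) (+-cancelˡ-≡ i _ _ (trans eq (sym eq′)))) (λ e → ≢ (trans (sym (+-suc (2 + j′) m)) (trans e (+-suc (2 + j′) m′))))
  ... | greater i t = apart-sym (apart-far (≤-diff (1 + 3 * t + 2 * j′ * t) (solve (j′ ∷ σ′ ∷ i ∷ t ∷ []))))
  apart (left i m eq) (left i′ m′ eq′) ≢ with compare i i′
  ... | less i t    = apart-far (≤-diff (1 + 3 * t + 2 * j′ * t) (solve (j′ ∷ σ′ ∷ i ∷ t ∷ [])))
  ... | equal i     = contradiction (+-cancelˡ-≡ i _ _ (trans eq (sym eq′))) ≢
  ... | greater i t = apart-sym (apart-far (≤-diff (1 + 3 * t + 2 * j′ * t) (solve (j′ ∷ σ′ ∷ i ∷ t ∷ []))))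

  bounds : ∀ {v φ x} → V v φ x → 1 ≤ x × x ≤ 4 + 2 * j′ + σ′ + j′ * (3 + 2 * j′)
  bounds start          = s≤s z≤n , ≤-diff (3 + 5 * j′ + σ′ + 2 * j′ * j′) (solve (j′ ∷ σ′ ∷ []))
  bounds last           = s≤s z≤n , ≤-diff (2 + 4 * j′ + σ′ + 2 * j′ * j′) (solve (j′ ∷ σ′ ∷ []))
  bounds leaf           = s≤s z≤n , ≤-diff (1 + 3 * j′ + σ′ + 2 * j′ * j′) (solve (j′ ∷ σ′ ∷ []))
  bounds (right i m eq) = s≤s z≤n , ≤-by (3 + 2 * j′ + 3 * m + 2 * j′ * m) (*-scale-≤ (3 + 2 * j′) (≤-reflexive eq)) (solve (j′ ∷ σ′ ∷ i ∷ m ∷ []))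
  bounds (left i m eq)  = s≤s z≤n , ≤-by (2 + j′ + 3 * m + 2 * j′ * m) (*-scale-≤ (3 + 2 * j′) (≤-reflexive eq)) (solve (j′ ∷ σ′ ∷ i ∷ m ∷ []))
  bounds finish         = s≤s z≤n , ≤-refl

  on-fold : ∀ {v φ x} → V v φ x → (v ≤ suc (suc j′ + suc j′) × φ ≡ v) ⊎ (v ≡ suc N × φ ≡ suc σ′ ∸ 1)
  on-fold start          = inj₁ (≤-diff (2 + j′) (solve (j′ ∷ [])) , refl)
  on-fold last           = inj₁ (≤-refl , refl)
  on-fold leaf           = inj₂ (refl , refl)
  on-fold (right i m eq) = inj₁ (≤-by (1 + i) (≤-reflexive eq) (solve (j′ ∷ m ∷ i ∷ [])) , refl)
  on-fold (left i m eq)  = inj₁ (≤-by (3 + i + j′) (≤-reflexive eq) (solve (m ∷ j′ ∷ i ∷ [])) , refl)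
  on-fold finish         = inj₁ (≤-diff (1 + j′) (solve (j′ ∷ [])) , refl)

  on-path : ∀ {u v x} → u ≡ v → V u u x → V v v x
  on-path refl A = A

  round : ∀ {m} → m < j′ → ∃ λ i → i + suc m ≡ j′
  round {m} m<j′ with i , eq ← m≤n⇒∃[o]m+o≡n m<j′ = i , trans (+-comm i (suc m)) eq

  locate-right : ∀ {m} → 3 + j′ + m ≤ N → ∃₂ (V (3 + j′ + m))
  locate-right {m} v≤N with m≤n⇒m<n∨m≡n (+-cancelˡ-≤ (3 + j′) m j′ (≤-trans v≤N (≤-reflexive (cong (2 +_) (+-suc j′ j′)))))
  ... | inj₂ refl = _ , _ , on-path (cong (2 +_) (+-suc j′ j′)) last
  ... | inj₁ m<j′ with i , eq ← round m<j′ = _ , _ , right i m eq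

  locate : ∀ {v} → 1 ≤ v → v ≤ suc N → ∃₂ (V v)
  locate {suc v} _ v≤ with m≤n⇒m<n∨m≡n v≤
  ... | inj₂ refl = _ , _ , leaf
  ... | inj₁ v<   with <-cmp v j′
  ...   | tri≈ _ refl _ = _ , _ , start
  ...   | tri< v<j′ _ _ with i , eq ← round v<j′ = _ , _ , left i v eq
  ...   | tri> _ _ j′<v with m≤n⇒∃[o]m+o≡n j′<v
  ...     | zero  , refl = _ , _ , on-path (cong (2 +_) (sym (+-identityʳ j′))) finish
  ...     | suc m , refl = subst (λ v → ∃₂ (V v)) (cong (2 +_) (sym (+-suc j′ m)))
                             (locate-right (≤-trans (≤-reflexive (cong (2 +_) (sym (+-suc j′ m)))) (≤-pred v<)))

  layout : Layout N (suc σ′) T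
  layout = record { V = V ; locate = locate ; on-fold = on-fold ; bounds = bounds ; apart = apart }

-- The radio number

layout⇒bound : ∀ {N s T} → Layout N s T → (∀ {c} → Separated N s c → ∃ λ i → 1 ≤ i × i ≤ suc N × T ≤ c i) →
               RadioBound N s
layout⇒bound {T = T} lay attained = record
  { value = T ; attained = attained ; labeling = labeling ; spread = spread
  ; bounded = λ 1≤i i≤ → proj₂ (bounds (proj₂ (labeled 1≤i i≤))) }
  where open Layout lay

odd-bound : ∀ s′ e → RadioBound ((2 + s′ + e) + (2 + s′ + e)) (2 + s′)
odd-bound s′ e = layout⇒bound (Odd.layout (1 + s′ + e) s′) attained
  where
  q = 1 + s′ + e
  N = suc q + suc q
  N≡ : ∀ q → suc q + suc q ≡ q + suc (suc q)
  N≡ = solve-∀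
  identity : ∀ s e → 2 * (1 + s + e) * (2 + s + e) + 2 * (2 + s)
      + ((1 + s + e) * (2 + s + e) + (2 + s + e) * (3 + s + e) + 2 * suc e)
    ≡ 1 + ((2 + s + e) + (2 + s + e)) * ((2 + s + e) + (2 + s + e)) + 1
  identity = solve-∀
  attained : ∀ {c} → Separated N (2 + s′) c → ∃ λ i → 1 ≤ i × i ≤ suc N × Odd.T q s′ ≤ c i
  attained sep = M.attained 1 refl refl (N≡ q) (N≡ q) M.positive-slack (identity s′ e)
    where module M = OneMiddle sep e (s≤s z≤n)

-- Here n = 2s, and the leaf hangs from the centre of the path. The bound comes from the single
-- middle v_s, with e = 0, and the labeling from j = s - 1.
central-bound : ∀ s′ → RadioBound (suc ((1 + s′) + (1 + s′))) (2 + s′)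
central-bound s′ = layout⇒bound (Central.layout s′ (suc s′) (n≤1+n s′) ≤-refl) attained
  where
  j = 1 + s′
  N = suc (j + j)
  identity : ∀ s → 4 + 2 * s + suc s + s * (3 + 2 * s) + ((1 + s) * (2 + s) + (1 + s) * (2 + s) + 2)
    ≡ 1 + suc ((1 + s) + (1 + s)) * suc ((1 + s) + (1 + s)) + 1
  identity = solve-∀
  attained : ∀ {c} → Separated N (2 + s′) c →
             ∃ λ i → 1 ≤ i × i ≤ suc N × Central.T s′ (suc s′) (n≤1+n s′) ≤-refl ≤ c i
  attained sep = M.attained 1 (+-identityʳ (2 + s′)) (+-identityʳ (2 + s′)) (sym (+-suc j j)) (sym (+-suc j j))
                            M.positive-slack (identity s′)
    where module M = OneMiddle sep 0 (s≤s z≤n)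

-- With j = s + e the least slack is 1 for e = 0 and 2 otherwise, which is why the two cases need
-- different labelings.
even-bound : ∀ s′ e → RadioBound (suc ((2 + s′ + e) + (2 + s′ + e))) (2 + s′)
even-bound s′ zero = layout⇒bound
  (subst (λ j → Layout (suc (j + j)) (2 + s′) T) (sym (+-identityʳ (2 + s′))) (Central.layout (suc s′) (suc s′) ≤-refl (n≤1+n _)))
  attained
  where
  j = 2 + s′ + 0
  N = suc (j + j)
  T = Central.T (suc s′) (suc s′) ≤-refl (n≤1+n _)
  N≡ : ∀ a → suc (suc a + suc a) ≡ a + (3 + a)
  N≡ = solve-∀
  identity : ∀ s → 4 + 2 * suc s + suc s + suc s * (3 + 2 * suc s)
      + ((1 + (s + 0)) * (2 + (s + 0)) + (2 + (s + 0)) * (3 + (s + 0)) + 2)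
    ≡ 1 + suc ((2 + (s + 0)) + (2 + (s + 0))) * ((2 + (s + 0)) + (2 + (s + 0))) + 1
  identity = solve-∀
  attained : ∀ {c} → Separated N (2 + s′) c → ∃ λ i → 1 ≤ i × i ≤ suc N × T ≤ c i
  attained sep = M.attained 1 refl refl (N≡ (1 + (s′ + 0))) (sym (+-suc j j)) M.positive-slack (identity s′)
    where module M = TwoMiddles {2 + s′} {0} sep (s≤s (s≤s z≤n))
even-bound s′ (suc e) = layout⇒bound
  (subst (λ j → Layout (suc (j + j)) (2 + s′) T) (cong (2 +_) (sym (+-suc s′ e))) (Even.layout (s′ + e) s′))
  attained
  where
  j = 2 + s′ + suc e
  N = suc (j + j)
  T = Even.T (s′ + e) s′
  N≡ : ∀ a → suc (suc a + suc a) ≡ a + (3 + a)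
  N≡ = solve-∀
  identity : ∀ s e → 2 * (3 + (s + e)) * (3 + (s + e)) + 2 * (2 + s) + 1
      + ((1 + (s + suc e)) * (2 + (s + suc e)) + (2 + (s + suc e)) * (3 + (s + suc e)) + 2 * suc (suc e))
    ≡ 1 + suc ((2 + (s + suc e)) + (2 + (s + suc e))) * ((2 + (s + suc e)) + (2 + (s + suc e))) + 2
  identity = solve-∀
  attained : ∀ {c} → Separated N (2 + s′) c → ∃ λ i → 1 ≤ i × i ≤ suc N × T ≤ c i
  attained sep = M.attained 2 refl refl (N≡ (1 + (s′ + suc e))) (sym (+-suc j j)) (M.slack≥2 (s≤s z≤n)) (identity s′ e)
    where module M = TwoMiddles {2 + s′} {suc e} sep (s≤s (s≤s z≤n))

halve : ∀ d → ∃ λ e → d ≡ e + e ⊎ d ≡ suc (e + e)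
halve zero = 0 , inj₁ refl
halve (suc d) with halve d
... | e , inj₁ refl = e , inj₂ refl
... | e , inj₂ refl = suc e , inj₁ (cong suc (sym (+-suc e e)))

-- The excess n - 2s tells the cases apart: if it is odd the middle is one vertex, if it is 0 the
-- middle is v_s, and if it is even and positive the middle is an edge.
radio-bound : ∀ {n s} → 2 ≤ s → s + s ≤ n → ∃ λ N → n ≡ suc N × RadioBound N s
radio-bound {s = suc (suc s′)} (s≤s (s≤s _)) 2s≤n with d , refl ← m≤n⇒∃[o]m+o≡n 2s≤n with halve d
... | e , inj₂ refl = _ , shift s′ e , odd-bound s′ e
  where
  shift : ∀ s e → (2 + s) + (2 + s) + suc (e + e) ≡ suc ((2 + s + e) + (2 + s + e))
  shift = solve-∀
... | zero , inj₁ refl = _ , shift s′ , central-bound s′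
  where
  shift : ∀ s → (2 + s) + (2 + s) + 0 ≡ suc (suc ((1 + s) + (1 + s)))
  shift = solve-∀
... | suc e , inj₁ refl = _ , shift s′ e , even-bound s′ e
  where
  shift : ∀ s e → (2 + s) + (2 + s) + (suc e + suc e) ≡ suc (suc ((2 + s + e) + (2 + s + e)))
  shift = solve-∀

double≤ : ∀ {n s} → s ≤ n / 2 → s + s ≤ n
double≤ {n} {s} s≤n/2 = ≤-trans (≤-reflexive (double s)) (≤-trans (*-monoˡ-≤ 2 s≤n/2) (m/n*n≤m n 2))
  where
  double : ∀ s → s + s ≡ s * 2
  double = solve-∀

same-radio-number : ∀ {n s E F} → 2 ≤ s → s ≤ n / 2 → Spire n s ⊆ E → E ⊆ Spire12 n s →
                    Spire n s ⊆ F → F ⊆ Spire12 n s → SameRadioNumber n E F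
same-radio-number {n} {s} 2≤s s≤n/2 E-lower E-upper F-lower F-upper
  with N , refl , B ← radio-bound 2≤s (double≤ {n} {s} s≤n/2) =
  RadioBound.value B , radio-number 2≤s (double≤ {n} {s} s≤n/2) E-lower E-upper B
                     , radio-number 2≤s (double≤ {n} {s} s≤n/2) F-lower F-upper B

spire⊆spire1 : ∀ {n s} → Spire n s ⊆ Spire1 n s
spire⊆spire1 (here e)  = here e
spire⊆spire1 (there e) = there (there e)

spire⊆spire2 : ∀ {n s} → Spire n s ⊆ Spire2 n s
spire⊆spire2 (here e)  = here e
spire⊆spire2 (there e) = there (there e)

spire1⊆spire12 : ∀ {n s} → Spire1 n s ⊆ Spire12 n s
spire1⊆spire12 (here e)          = here e
spire1⊆spire12 (there (here e))  = there (here e)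
spire1⊆spire12 (there (there e)) = there (there (there e))

spire2⊆spire12 : ∀ {n s} → Spire2 n s ⊆ Spire12 n s
spire2⊆spire12 (here e)  = here e
spire2⊆spire12 (there e) = there (there e)

spire⊆spire12 : ∀ {n s} → Spire n s ⊆ Spire12 n s
spire⊆spire12 e = spire2⊆spire12 (spire⊆spire2 e)

mainTheorem8 : (n : ℕ) → 4 ≤ n →
    ((s : ℕ) → 2 ≤ s → s ≤ n / 2 → SameRadioNumber n (Spire1 n s) (Spire n s)) ×
    ((s : ℕ) → 3 ≤ s → s ≤ n / 2 →
    SameRadioNumber n (Spire2 n s) (Spire n s) × SameRadioNumber n (Spire12 n s) (Spire n s))
mainTheorem8 n _ =
  (λ s 2≤s s≤ → same-radio-number 2≤s s≤ spire⊆spire1 spire1⊆spire12 (λ e → e) spire⊆spire12) ,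
  (λ s 3≤s s≤ → same-radio-number (<⇒≤ 3≤s) s≤ spire⊆spire2 spire2⊆spire12 (λ e → e) spire⊆spire12
             , same-radio-number (<⇒≤ 3≤s) s≤ spire⊆spire12 (λ e → e) (λ e → e) spire⊆spire12)
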